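{- Let $a,b,c\in\mathbb{Z}^{+}$ and consider the five forms (1) $ax^2+by^2+cT_z$, (2) $aT_x+bT_y+cz^2$, (3) $aT_x+bT_y+cT_z$, (4) $ax^2+bT_y+cz^2$, (5) $ax^2+bT_y+cT_z$. (i) If $a'\equiv b'\equiv -c'\pmod 8$, then none of (1)-(5) is asymptotically universal. (ii) If either - $a'\equiv b'\equiv c'+4\pmod 8$ and $v_2(a)\not\equiv v_2(b)\pmod 2$, or - $\varepsilon a'\equiv -b'\equiv c'+4\pmod 8$ for some sign $\varepsilon\in\{1,-1\}$ and $v_2(a)\equiv v_2(b)\pmod 2$, then none of (1)-(3) is asymptotically universal. (iii) If either - $a'\equiv b'\equiv c'+4\pmod 8$ and $v_2(a)\equiv v_2(b)\pmod 2$, or - $\varepsilon a'\equiv -b'\equiv c'+4\pmod 8$ for some sign $\varepsilon\in\{1,-1\}$ and $v_2(a)\not\equiv v_2(b)\pmod 2$, then neither (4) nor (5) is asymptotically universal.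
   Context: $\mathbb{Z}^{+}=\{1,2,3,\ldots\}$. For $x\in\mathbb{Z}$, $T_x=x(x+1)/2$. A form $f(x,y,z)$ of one of the listed types (variables ranging over $\mathbb{Z}$) is asymptotically universal if $\lim_{N\to\infty}\frac1N|\{1\le n\le N: n=f(x,y,z)\text{ for some }x,y,z\in\mathbb{Z}\}|=1$. For a positive integer $n$, $v_2(n)$ is the 2-adic order of $n$ and $n'=n/2^{v_2(n)}$ is the odd part of $n$. -}

module Defs where

open import Data.Integer.Base as ℤ using (ℤ; +_; -[1+_]; +[1+_]; ∣_∣)
open import Data.Integer.Divisibility.Signed using (_∣_)
import Data.Integer.Properties as ℤ
open import Data.List.Base using (applyUpTo; filter; length)
open import Data.Nat.Base as ℕ using (ℕ; zero; suc; NonZero; z≤n; s≤s)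
import Data.Nat.Divisibility as ℕ
import Data.Nat.DivMod as ℕ
import Data.Nat.Properties as ℕ
open import Data.Product.Base using (∃; ∃-syntax; _×_; _,_; proj₁; proj₂)
open import Data.Rational.Base as ℚ using (ℚ; 0ℚ; 1ℚ)
open import Relation.Binary.PropositionalEquality
open import Relation.Nullary using (Dec; yes; no)
open import Relation.Unary using (Decidable)

infix 4 _≡_[mod_]

_≡_[mod_] : ℤ → ℤ → ℕ → Set
x ≡ y [mod m ] = + m ∣ x ℤ.- y

-- The largest k ≤ bound such that 2 ^ k ∣ n.
largestPower : (bound n : ℕ) → ℕ
largestPower zero    n = 0
largestPower (suc k) n with 2 ℕ.^ suc k ℕ.∣? n
... | yes _ = suc k
... | no  _ = largestPower k n

-- For n > 0 the bound n loses nothing, since 2 ^ k ∣ n forces k < 2 ^ k ≤ n.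
-- (The value v₂ 0 = 0 is meaningless.)
v₂ : ℕ → ℕ
v₂ n = largestPower n n

oddPart : ℕ → ℕ
oddPart n = (n ℕ./ 2 ℕ.^ v₂ n) {{ℕ.m^n≢0 2 (v₂ n)}}

-- The division is exact, as x (x + 1) is even.
T : ℤ → ℤ
T x = (x ℤ.* (x ℤ.+ + 1)) ℤ./ℕ 2

data Form : Set where
  form₁ form₂ form₃ form₄ form₅ : Form

module _ where
  open import Data.Integer.Base using (_+_; _*_; _^_)

  eval : Form → (a b c : ℕ) → (x y z : ℤ) → ℤ
  eval form₁ a b c x y z = + a * x ^ 2 + + b * y ^ 2 + + c * T z
  eval form₂ a b c x y z = + a * T x   + + b * T y   + + c * z ^ 2
  eval form₃ a b c x y z = + a * T x   + + b * T y   + + c * T z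
  eval form₄ a b c x y z = + a * x ^ 2 + + b * T y   + + c * z ^ 2
  eval form₅ a b c x y z = + a * x ^ 2 + + b * T y   + + c * T z

Represents : Form → (a b c : ℕ) → ℕ → Set
Represents F a b c n = ∃[ x ] ∃[ y ] ∃[ z ] + n ≡ eval F a b c x y z

-- Representability is decidable: each of p x = x ^ 2 and p x = T x is
-- non-negative and satisfies ∣ x ∣ ≤ 1 + p x, so + n ≡ eval F a b c x y z
-- confines x, y and z to absolute value at most 1 + n.
private
  Growing : (ℤ → ℤ) → Set
  Growing p = ∀ x → ∃[ m ] (p x ≡ + m × ∣ x ∣ ℕ.≤ suc m)

  square-growing : Growing (ℤ._^ 2)
  square-growing x = ∣ x ∣ ℕ.* ∣ x ∣ , eq x , bound ∣ x ∣
    where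
    eq : ∀ x → x ℤ.^ 2 ≡ + (∣ x ∣ ℕ.* ∣ x ∣)
    eq x = trans (cong (x ℤ.*_) (ℤ.*-identityʳ x)) (x*x x)
      where
      x*x : ∀ x → x ℤ.* x ≡ + (∣ x ∣ ℕ.* ∣ x ∣)
      x*x (+ n)    = sym (ℤ.pos-* n n)
      x*x -[1+ n ] = refl
    bound : ∀ n → n ℕ.≤ suc (n ℕ.* n)
    bound zero    = z≤n
    bound (suc n) = ℕ.m≤n⇒m≤1+n (ℕ.m≤m*n (suc n) (suc n))

  half-bound : ∀ n k → 1 ℕ.≤ n → suc n ℕ.≤ k → n ℕ.≤ n ℕ.* k ℕ./ 2
  half-bound n k 1≤n n<k = begin
    n               ≡⟨ ℕ.m*n/n≡m n 2 ⟨
    n ℕ.* 2 ℕ./ 2   ≤⟨ ℕ./-monoˡ-≤ 2 (ℕ.*-monoʳ-≤ n (ℕ.≤-trans (s≤s 1≤n) n<k)) ⟩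
    n ℕ.* k ℕ./ 2   ∎
    where open ℕ.≤-Reasoning

  T-growing : Growing T
  T-growing (+ zero)   = 0 , refl , z≤n
  T-growing +[1+ n ]   =
    suc n ℕ.* (suc n ℕ.+ 1) ℕ./ 2 , refl ,
    ℕ.m≤n⇒m≤1+n (half-bound (suc n) _ (s≤s z≤n) (ℕ.≤-reflexive (ℕ.+-comm 1 (suc n))))
  T-growing -[1+ zero ]  = 0 , refl , s≤s z≤n
  T-growing -[1+ suc n ] =
    suc (suc n) ℕ.* suc n ℕ./ 2 , refl ,
    s≤s (subst (λ k → suc n ℕ.≤ k ℕ./ 2) (ℕ.*-comm (suc n) (suc (suc n)))
               (half-bound (suc n) _ (s≤s z≤n) ℕ.≤-refl))

  any-bounded? : {P : ℤ → Set} (B : ℕ) → Decidable P →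
                 (∀ x → P x → ∣ x ∣ ℕ.≤ B) → Dec (∃ P)
  any-bounded? {P} B P? P⇒≤B
    with ℕ.anyUpTo? (λ n → P? (+ n)) (suc B) | ℕ.anyUpTo? (λ n → P? -[1+ n ]) (suc B)
  ... | yes (n , _ , p) | _               = yes (+ n , p)
  ... | no _            | yes (n , _ , p) = yes (-[1+ n ] , p)
  ... | no ¬pos         | no ¬neg         = no λ where
    (+ n      , p) → ¬pos (n , s≤s (P⇒≤B (+ n) p) , p)
    (-[1+ n ] , p) → ¬neg (n , ℕ.m≤n⇒m≤1+n (P⇒≤B -[1+ n ] p) , p)

  module _ {p q r : ℤ → ℤ} (gp : Growing p) (gq : Growing q) (gr : Growing r)
           (a b c : ℕ) {{_ : NonZero a}} {{_ : NonZero b}} {{_ : NonZero c}} (n : ℕ)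
    where

    value : ℤ → ℤ → ℤ → ℤ
    value x y z = + a ℤ.* p x ℤ.+ + b ℤ.* q y ℤ.+ + c ℤ.* r z

    bounds : ∀ x y z → + n ≡ value x y z →
             ∣ x ∣ ℕ.≤ suc n × ∣ y ∣ ℕ.≤ suc n × ∣ z ∣ ℕ.≤ suc n
    bounds x y z eq with gp x | gq y | gr z
    ... | k , p≡k , x≤ | l , q≡l , y≤ | m , r≡m , z≤ =
      ℕ.≤-trans x≤ (s≤s (begin
        k                               ≤⟨ ℕ.m≤n*m k a ⟩
        a ℕ.* k                         ≤⟨ ℕ.m≤m+n _ _ ⟩
        a ℕ.* k ℕ.+ b ℕ.* l             ≤⟨ ℕ.m≤m+n _ _ ⟩
        a ℕ.* k ℕ.+ b ℕ.* l ℕ.+ c ℕ.* m ≡⟨ n≡ ⟨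
        n                               ∎)) ,
      ℕ.≤-trans y≤ (s≤s (begin
        l                               ≤⟨ ℕ.m≤n*m l b ⟩
        b ℕ.* l                         ≤⟨ ℕ.m≤n+m _ _ ⟩
        a ℕ.* k ℕ.+ b ℕ.* l             ≤⟨ ℕ.m≤m+n _ _ ⟩
        a ℕ.* k ℕ.+ b ℕ.* l ℕ.+ c ℕ.* m ≡⟨ n≡ ⟨
        n                               ∎)) ,
      ℕ.≤-trans z≤ (s≤s (begin
        m                               ≤⟨ ℕ.m≤n*m m c ⟩
        c ℕ.* m                         ≤⟨ ℕ.m≤n+m _ _ ⟩
        a ℕ.* k ℕ.+ b ℕ.* l ℕ.+ c ℕ.* m ≡⟨ n≡ ⟨
        n                               ∎))
      where
      open ℕ.≤-Reasoning
      term : ∀ d {t j} → t ≡ + j → + d ℤ.* t ≡ + (d ℕ.* j)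
      term d {j = j} t≡j = trans (cong (+ d ℤ.*_) t≡j) (sym (ℤ.pos-* d j))
      n≡ : n ≡ a ℕ.* k ℕ.+ b ℕ.* l ℕ.+ c ℕ.* m
      n≡ = ℤ.+-injective (trans eq
             (cong₂ ℤ._+_ (cong₂ ℤ._+_ (term a p≡k) (term b q≡l)) (term c r≡m)))

    value? : Dec (∃[ x ] ∃[ y ] ∃[ z ] + n ≡ value x y z)
    value? =
      any-bounded? (suc n) (λ x →
        any-bounded? (suc n) (λ y →
          any-bounded? (suc n) (λ z → + n ℤ.≟ value x y z)
            (λ z e → proj₂ (proj₂ (bounds x y z e))))
          (λ { y (z , e) → proj₁ (proj₂ (bounds x y z e)) }))
        (λ { x (y , z , e) → proj₁ (bounds x y z e) })

represents? : ∀ F a b c {{_ : NonZero a}} {{_ : NonZero b}} {{_ : NonZero c}} →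
              Decidable (Represents F a b c)
represents? form₁ = value? square-growing square-growing T-growing
represents? form₂ = value? T-growing T-growing square-growing
represents? form₃ = value? T-growing T-growing T-growing
represents? form₄ = value? square-growing T-growing square-growing
represents? form₅ = value? square-growing T-growing T-growing

-- The number of n with 1 ≤ n ≤ N satisfying P.
count : {P : ℕ → Set} → Decidable P → ℕ → ℕ
count P? N = length (filter P? (applyUpTo suc N))

HasLimit : ((N : ℕ) .{{_ : NonZero N}} → ℚ) → ℚ → Set
HasLimit u ℓ = ∀ ε → 0ℚ ℚ.< ε →
  ∃[ N₀ ] (∀ N .{{_ : NonZero N}} → N₀ ℕ.≤ N → ℚ.∣ u N ℚ.- ℓ ∣ ℚ.< ε)

AsymptoticallyUniversal : Form → (a b c : ℕ)
  {{_ : NonZero a}} {{_ : NonZero b}} {{_ : NonZero c}} → Set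
AsymptoticallyUniversal F a b c =
  HasLimit (λ N → + count (represents? F a b c) N ℚ./ N) 1ℚ

module Submission where

open import Defs
import Algebra.Properties.CommutativeMonoid.Sum
import Algebra.Solver.Ring.AlmostCommutativeRing as ACR
import Algebra.Solver.Ring.Simple
open import Data.Bool.Base as Bool using (Bool; true; false)
open import Data.Fin.Base as Fin using (Fin; toℕ; fromℕ<)
open import Data.Fin.Permutation using (permutation)
import Data.Fin.Properties as Fin
open import Data.Integer.Base as ℤ
  using (ℤ; +_; -[1+_]; -_; _+_; _*_; _-_; _^_; 1ℤ; -1ℤ; ∣_∣; _%ℕ_; _/ℕ_)
open import Data.Integer.Divisibility.Signed
open import Data.Integer.DivMod using (a≡a%ℕn+[a/ℕn]*n; n%ℕd<d)
import Data.Integer.Properties as ℤ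
open import Data.Integer.Tactic.RingSolver using (solve-∀)
open import Data.List.Base as List using ([]; _∷_; _∷ʳ_; applyUpTo; filter; length)
import Data.List.Properties as List
open import Data.Nat.Base as ℕ using (ℕ; zero; suc; NonZero; parity; ⌊_/2⌋)
open import Data.Nat.Coprimality as ℕ using (Coprime; coprime-Bézout)
import Data.Nat.DivMod as ℕ
import Data.Nat.Divisibility as ℕ
open import Data.Nat.GCD as ℕ using (gcd; module Bézout)
open import Data.Nat.Induction using (<-wellFounded)
import Data.Nat.Properties as ℕ
import Data.Nat.Tactic.RingSolver as ℕ-Ring
open import Data.Parity.Base as ℙ using (Parity; 0ℙ; 1ℙ)
import Data.Parity.Properties as ℙ
open import Data.Product.Base using (∃-syntax; _×_; _,_; proj₁; proj₂)
open import Data.Rational.Base as ℚ using (0ℚ; 1ℚ; toℚᵘ)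
import Data.Rational.Properties as ℚ
open import Data.Rational.Unnormalised.Base as ℚᵘ using (mkℚᵘ)
import Data.Rational.Unnormalised.Properties as ℚᵘ
open import Data.Sum.Base using (_⊎_; inj₁; inj₂)
open import Function.Base using (_$_)
open import Induction.WellFounded using (Acc; acc)
open import Relation.Binary.PropositionalEquality
open import Relation.Nullary using (¬_; yes; no; contradiction; _×-dec_)
open import Relation.Unary using (Decidable)

open Algebra.Properties.CommutativeMonoid.Sum ℙ.+-0-commutativeMonoid
module ℙ-Solver = Algebra.Solver.Ring.Simple (ACR.fromCommutativeRing ℙ.+-*-commutativeRing) ℙ._≟_

-- Completing squares, 8 n + s = α X² + β Y² + γ Z² whenever n is represented,
-- where α = 2 ^ i A, β = 2 ^ j B, γ = 2 ^ k C and A, B, C are the odd parts of a, b, c.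
-- A missed residue class costs density, so if the original form is asymptotically universal,
-- α X² + β Y² + γ Z² represents every residue modulo every odd m. Removing square factors
-- and passing from (g A , g B , C) to (A , B , g C) preserves this property, so one may assume
-- that A, B, C are squarefree and pairwise coprime. Representing - α β γ modulo A²
-- then makes - β γ a square modulo A, and similarly for B and C. Multiplying the three
-- Jacobi symbols and applying reciprocity shows that the ternary form is anisotropic over
-- ℚ₂ (it is isotropic at all odd primes and anisotropic at ∞), whereas the hypotheses on a, b, c
-- say that it is isotropic over ℚ₂.

-- Congruences and units

infix 4 _≡[_]_

-- A record, so that x and y can be inferred from x ≡[ m ] y.
record _≡[_]_ (x : ℤ) (m : ℕ) (y : ℤ) : Set where
  constructor congruent
  field
    ∣-difference : + m ∣ x - y

open _≡[_]_

∣-lin₁ : ∀ {k e e₁} u → e ≡ u * e₁ → k ∣ e₁ → k ∣ e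
∣-lin₁ u refl p = ∣n⇒∣m*n u p

∣-lin₂ : ∀ {k e e₁ e₂} u v → e ≡ u * e₁ + v * e₂ → k ∣ e₁ → k ∣ e₂ → k ∣ e
∣-lin₂ u v refl p q = ∣m∣n⇒∣m+n (∣n⇒∣m*n u p) (∣n⇒∣m*n v q)

module _ {m : ℕ} where

  ≡mod-lin₁ : ∀ {x y x₁ y₁} u → x - y ≡ u * (x₁ - y₁) → x₁ ≡[ m ] y₁ → x ≡[ m ] y
  ≡mod-lin₁ u e (congruent p) = congruent (∣-lin₁ u e p)

  ≡mod-lin₂ : ∀ {x y x₁ y₁ x₂ y₂} u v → x - y ≡ u * (x₁ - y₁) + v * (x₂ - y₂) →
              x₁ ≡[ m ] y₁ → x₂ ≡[ m ] y₂ → x ≡[ m ] y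
  ≡mod-lin₂ u v e (congruent p) (congruent q) = congruent (∣-lin₂ u v e p q)

  ≡mod-reflexive : ∀ {x y} → x ≡ y → x ≡[ m ] y
  ≡mod-reflexive {x} refl = congruent (divides (+ 0) (ℤ.i≡j⇒i-j≡0 {x} refl))

  ≡mod-refl : ∀ {x} → x ≡[ m ] x
  ≡mod-refl = ≡mod-reflexive refl

  ≡mod-sym : ∀ {x y} → x ≡[ m ] y → y ≡[ m ] x
  ≡mod-sym {x} {y} = ≡mod-lin₁ -1ℤ (eq x y)
    where
    eq : ∀ x y → y - x ≡ -1ℤ * (x - y)
    eq = solve-∀

  ≡mod-trans : ∀ {x y z} → x ≡[ m ] y → y ≡[ m ] z → x ≡[ m ] z
  ≡mod-trans {x} {y} {z} = ≡mod-lin₂ 1ℤ 1ℤ (eq x y z)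
    where
    eq : ∀ x y z → x - z ≡ 1ℤ * (x - y) + 1ℤ * (y - z)
    eq = solve-∀

  *-cong-mod : ∀ {x x′ y y′} → x ≡[ m ] x′ → y ≡[ m ] y′ → x * y ≡[ m ] x′ * y′
  *-cong-mod {x} {x′} {y} {y′} = ≡mod-lin₂ y x′ (eq x x′ y y′)
    where
    eq : ∀ x x′ y y′ → x * y - x′ * y′ ≡ y * (x - x′) + x′ * (y - y′)
    eq = solve-∀

  ∣⇒≡0 : ∀ {x} → + m ∣ x → x ≡[ m ] + 0
  ∣⇒≡0 {x} m∣x = congruent (subst (+ m ∣_) (sym (ℤ.+-identityʳ x)) m∣x)

  ≡0⇒∣ : ∀ {x} → x ≡[ m ] + 0 → + m ∣ x
  ≡0⇒∣ {x} (congruent m∣x) = subst (+ m ∣_) (ℤ.+-identityʳ x) m∣x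

multiple-in-range : ∀ {n k} → n ℕ.∣ k → k ℕ.< n → k ≡ 0
multiple-in-range {k = zero}  _   _   = refl
multiple-in-range {k = suc k} n∣k k<n = contradiction (ℕ.∣⇒≤ n∣k) (ℕ.<⇒≱ k<n)

≡mod⇒≡ : ∀ {n i j} → i ℕ.< n → j ℕ.< n → + i ≡[ n ] + j → i ≡ j
≡mod⇒≡ {n} {i} {j} i<n j<n (congruent n∣i-j) =
  ℤ.+-injective (ℤ.i-j≡0⇒i≡j (+ i) (+ j)
    (ℤ.∣i∣≡0⇒i≡0 (multiple-in-range (∣⇒∣ᵤ n∣i-j) (ℕ.≤-<-trans bound (ℕ.⊔-lub i<n j<n)))))
  where
  bound : ∣ + i - + j ∣ ℕ.≤ i ℕ.⊔ j
  bound = subst (λ e → ∣ e ∣ ℕ.≤ i ℕ.⊔ j) (sym (ℤ.[+m]-[+n]≡m⊖n i j)) (ℤ.∣m⊝n∣≤m⊔n i j)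

%ℕ-mod : ∀ x n .{{_ : NonZero n}} → x ≡[ n ] + (x %ℕ n)
%ℕ-mod x n = congruent (divides (x /ℕ n)
  (trans (cong (_- + (x %ℕ n)) (a≡a%ℕn+[a/ℕn]*n x n)) (eq (+ (x %ℕ n)) (x /ℕ n * + n))))
  where
  eq : ∀ r q → r + q - r ≡ q
  eq = solve-∀

record Unit (n : ℕ) (a : ℤ) : Set where
  constructor unit
  field
    inverse   : ℤ
    *-inverse : a * inverse ≡[ n ] 1ℤ

module _ {n : ℕ} where

  unit-* : ∀ {a b} → Unit n a → Unit n b → Unit n (a * b)
  unit-* {a} {b} (unit u au) (unit v bv) = unit (u * v) $ ≡mod-lin₂ (b * v) 1ℤ (eq a b u v) au bv
    where
    eq : ∀ a b u v → a * b * (u * v) - 1ℤ ≡ b * v * (a * u - 1ℤ) + 1ℤ * (b * v - 1ℤ)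
    eq = solve-∀

  unit-factorˡ : ∀ a b → Unit n (a * b) → Unit n a
  unit-factorˡ a b (unit u abu) = unit (b * u) $ subst (_≡[ n ] 1ℤ) (ℤ.*-assoc a b u) abu

  unit-cong : ∀ {a b} → a ≡[ n ] b → Unit n a → Unit n b
  unit-cong {a} {b} a≡b (unit u au) = unit u $ ≡mod-lin₂ (- u) 1ℤ (eq a b u) a≡b au
    where
    eq : ∀ a b u → b * u - 1ℤ ≡ - u * (a - b) + 1ℤ * (a * u - 1ℤ)
    eq = solve-∀

  unit-cancel : ∀ {a} x → Unit n a → + n ∣ a * x → + n ∣ x
  unit-cancel {a} x (unit u (congruent au)) n∣ax = ∣-lin₂ u (- x) (eq a x u) n∣ax au
    where
    eq : ∀ a x u → x ≡ u * (a * x) + - x * (a * u - 1ℤ)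
    eq = solve-∀

  unit-inverse : ∀ {a} (ua : Unit n a) → Unit n (Unit.inverse ua)
  unit-inverse {a} (unit u au) = unit a $ subst (_≡[ n ] 1ℤ) (ℤ.*-comm a u) au

  unit--1 : Unit n -1ℤ
  unit--1 = unit -1ℤ ≡mod-refl

-- The parity of N (N + 1) / 2.  For the odd number A = 2 N + 1 the pair
-- (parity N , triangular N) is the class of A in (ℤ/8)ˣ.
triangular : ℕ → Parity
triangular zero    = 0ℙ
triangular (suc n) = triangular n ℙ.+ parity (suc n)

sgn : Parity → ℤ
sgn 0ℙ = 1ℤ
sgn 1ℙ = -1ℤ

sgn-+ : ∀ p q → sgn (p ℙ.+ q) ≡ sgn p * sgn q
sgn-+ 0ℙ q  = sym (ℤ.*-identityˡ (sgn q))
sgn-+ 1ℙ 0ℙ = refl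
sgn-+ 1ℙ 1ℙ = refl

sgn-sq : ∀ p → sgn p * sgn p ≡ 1ℤ
sgn-sq 0ℙ = refl
sgn-sq 1ℙ = refl

sgn-cancel : ∀ {n} s t x y → sgn s * x ≡[ n ] sgn t * y →
             s ≡ t × x ≡[ n ] y ⊎ x ≡[ n ] (- y)
sgn-cancel 0ℙ 0ℙ x y e = inj₁ (refl , ≡mod-lin₁ 1ℤ (eq x y) e)
  where
  eq : ∀ x y → x - y ≡ 1ℤ * (1ℤ * x - 1ℤ * y)
  eq = solve-∀
sgn-cancel 1ℙ 1ℙ x y e = inj₁ (refl , ≡mod-lin₁ -1ℤ (eq x y) e)
  where
  eq : ∀ x y → x - y ≡ -1ℤ * (-1ℤ * x - -1ℤ * y)
  eq = solve-∀
sgn-cancel 0ℙ 1ℙ x y e = inj₂ (≡mod-lin₁ 1ℤ (eq x y) e)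
  where
  eq : ∀ x y → x - - y ≡ 1ℤ * (1ℤ * x - -1ℤ * y)
  eq = solve-∀
sgn-cancel 1ℙ 0ℙ x y e = inj₂ (≡mod-lin₁ -1ℤ (eq x y) e)
  where
  eq : ∀ x y → x - - y ≡ -1ℤ * (-1ℤ * x - 1ℤ * y)
  eq = solve-∀

parity-2* : ∀ n → parity (2 ℕ.* n) ≡ 0ℙ
parity-2* n = ℙ.*-homo-* 2 n

parity-suc : ∀ n → parity (suc n) ≡ 1ℙ ℙ.+ parity n
parity-suc n = ℙ.+-homo-+ 1 n

-- The Jacobi symbol

-- The Jacobi symbol of a modulo n = 2 N + 1, written additively and defined
-- by Gauss's lemma, which (as Schering observed) needs no primality.
module Gauss (N : ℕ) where

  n : ℕ
  n = suc (2 ℕ.* N)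

  N<n : N ℕ.< n
  N<n = ℕ.s≤s (ℕ.m≤m+n N _)

  ι : Fin N → ℕ
  ι i = suc (toℕ i)

  ι≤N : ∀ i → ι i ℕ.≤ N
  ι≤N i = Fin.toℕ<n i

  ι<n : ∀ i → ι i ℕ.< n
  ι<n i = ℕ.≤-<-trans (ι≤N i) N<n

  ι-injective : ∀ {i j} → ι i ≡ ι j → i ≡ j
  ι-injective e = Fin.toℕ-injective (ℕ.suc-injective e)

  ι+ι≢0 : ∀ i j → ¬ + ι i ≡[ n ] (- + ι j)
  ι+ι≢0 i j (congruent n∣) = contradiction (multiple-in-range n∣sum sum<n) λ ()
    where
    n∣sum : n ℕ.∣ ι i ℕ.+ ι j
    n∣sum = ∣⇒∣ᵤ (subst (λ e → + n ∣ + ι i + e) (ℤ.neg-involutive (+ ι j)) n∣)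
    sum<n : ι i ℕ.+ ι j ℕ.< n
    sum<n = ℕ.s≤s (ℕ.≤-trans (ℕ.+-mono-≤ (ι≤N i) (ι≤N j)) (ℕ.≤-reflexive (cong (N ℕ.+_) (sym (ℕ.+-identityʳ N)))))

  residue-unique : ∀ s t i j → sgn s * + ι i ≡[ n ] sgn t * + ι j → s ≡ t × i ≡ j
  residue-unique s t i j e with sgn-cancel {n} s t (+ ι i) (+ ι j) e
  ... | inj₁ (s≡t , e′) = s≡t , ι-injective (≡mod⇒≡ (ι<n i) (ι<n j) e′)
  ... | inj₂ e′         = contradiction e′ (ι+ι≢0 i j)

  upper : ℕ → Parity
  upper r with r ℕ.≤? N
  ... | yes _ = 0ℙ
  ... | no  _ = 1ℙ

  ι-surjective : ∀ {r} → 1 ℕ.≤ r → r ℕ.≤ N → ∃[ i ] r ≡ ι i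
  ι-surjective {suc r} _ r<N = fromℕ< r<N , cong suc (sym (Fin.toℕ-fromℕ< r<N))

  reflect : ∀ r → 1 ℕ.≤ r → r ℕ.< n →
            ∃[ i ] (+ r ≡[ n ] sgn (upper r) * + ι i × parity r ≡ parity (ι i) ℙ.+ upper r)
  reflect r 1≤r r<n with r ℕ.≤? N
  ... | yes r≤N with ι-surjective 1≤r r≤N
  ...   | i , refl = i , ≡mod-reflexive (sym (ℤ.*-identityˡ (+ ι i))) , sym (ℙ.+-identityʳ _)
  reflect r 1≤r r<n | no r≰N with ι-surjective {n ℕ.∸ r} (ℕ.m<n⇒0<n∸m r<n) n-r≤N
    where
    n-r≤N : n ℕ.∸ r ℕ.≤ N
    n-r≤N = ℕ.≤-trans (ℕ.∸-monoʳ-≤ n (ℕ.≰⇒> r≰N))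
              (ℕ.≤-reflexive (trans (ℕ.m+n∸m≡n N _) (ℕ.+-identityʳ N)))
  ...   | i , n-r≡ιi = i , congruent (divides 1ℤ cong-eq) , parity-eq
    where
    sum≡n : r ℕ.+ ι i ≡ n
    sum≡n = trans (cong (r ℕ.+_) (sym n-r≡ιi)) (ℕ.m+[n∸m]≡n (ℕ.<⇒≤ r<n))
    eq : ∀ x y → x - -1ℤ * y ≡ 1ℤ * (x + y)
    eq = solve-∀
    cong-eq : + r - -1ℤ * + ι i ≡ 1ℤ * + n
    cong-eq = trans (eq (+ r) (+ ι i)) (cong (λ e → 1ℤ * + e) sum≡n)
    parity-eq : parity r ≡ parity (ι i) ℙ.+ 1ℙ
    parity-eq = solve-parity (parity r) (parity (ι i))
      (trans (sym (ℙ.+-homo-+ r (ι i))) (trans (cong parity sum≡n) (trans (parity-suc (2 ℕ.* N)) (cong (1ℙ ℙ.+_) (parity-2* N)))))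
      where
      solve-parity : ∀ p q → p ℙ.+ q ≡ 1ℙ → p ≡ q ℙ.+ 1ℙ
      solve-parity 0ℙ 1ℙ _ = refl
      solve-parity 1ℙ 0ℙ _ = refl

  -- The sign s with x ≡ sgn s * k for some 1 ≤ k ≤ N.
  σ : ℤ → Parity
  σ x = upper (x %ℕ n)

  residue : ∀ x → ¬ + n ∣ x → ∃[ i ] x ≡[ n ] sgn (σ x) * + ι i
  residue x n∤x = let i , r≡ , _ = reflect (x %ℕ n) 1≤r (n%ℕd<d x n) in i , ≡mod-trans (%ℕ-mod x n) r≡
    where
    1≤r : 1 ℕ.≤ x %ℕ n
    1≤r = ℕ.n≢0⇒n>0 λ r≡0 → n∤x (≡0⇒∣ (subst (λ r → x ≡[ n ] + r) r≡0 (%ℕ-mod x n)))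

  ι∤ : ∀ {a} → Unit n a → ∀ i → ¬ + n ∣ a * + ι i
  ι∤ ua i n∣ = contradiction (multiple-in-range (∣⇒∣ᵤ (unit-cancel (+ ι i) ua n∣)) (ι<n i)) λ ()

  ∤-sgn : ∀ s i → ¬ + n ∣ sgn s * + ι i
  ∤-sgn s = ι∤ {sgn s} (unit (sgn s) (≡mod-reflexive (sgn-sq s)))

  σ-unique : ∀ {x} s i → x ≡[ n ] sgn s * + ι i → σ x ≡ s
  σ-unique {x} s i e =
    let j , e′ = residue x λ n∣x → ∤-sgn s i (≡0⇒∣ (≡mod-trans (≡mod-sym e) (∣⇒≡0 n∣x)))
    in proj₁ (residue-unique (σ x) s j i (≡mod-trans (≡mod-sym e′) e))

  jacobi : ℤ → Parity
  jacobi a = ∑[ i < N ] σ (a * + ι i)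

  module _ {a : ℤ} (ua : Unit n a) where

    π : Fin N → Fin N
    π i = proj₁ (residue (a * + ι i) (ι∤ ua i))

    π-spec : ∀ i → a * + ι i ≡[ n ] sgn (σ (a * + ι i)) * + ι (π i)
    π-spec i = proj₂ (residue (a * + ι i) (ι∤ ua i))

  π-inverse : ∀ {a b} (ua : Unit n a) (ub : Unit n b) → a * b ≡[ n ] 1ℤ → ∀ i → π ub (π ua i) ≡ i
  π-inverse {a} {b} ua ub ab≡1 i =
    proj₂ (residue-unique t s (π ub (π ua i)) i
      (≡mod-trans (≡mod-sym (π-spec ub (π ua i)))
        (≡mod-lin₂ (- sgn s * b) (+ ι i * sgn s) (eq (sgn s) a b (+ ι i) (+ ι (π ua i)) (sgn-sq s))
           (π-spec ua i) ab≡1)))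
    where
    s = σ (a * + ι i)
    t = σ (b * + ι (π ua i))
    eq′ : ∀ s a b x y → b * (s * s * y) - s * x ≡ - s * b * (a * x - s * y) + x * s * (a * b - 1ℤ)
    eq′ = solve-∀
    eq : ∀ s a b x y → s * s ≡ 1ℤ → b * y - s * x ≡ - s * b * (a * x - s * y) + x * s * (a * b - 1ℤ)
    eq s a b x y ss = trans (cong (λ e → b * e - s * x) (trans (sym (ℤ.*-identityˡ y)) (cong (_* y) (sym ss)))) (eq′ s a b x y)

  ∑-reindex : ∀ {a} (ua : Unit n a) (f : Fin N → Parity) → ∑[ i < N ] f i ≡ ∑[ i < N ] f (π ua i)
  ∑-reindex {a} ua f = ∑-permute f (permutation (π ua) (π ua⁻¹)
    (λ i → π-inverse ua⁻¹ ua (Unit.*-inverse ua⁻¹) i) (λ i → π-inverse ua ua⁻¹ (Unit.*-inverse ua) i))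
    where
    ua⁻¹ = unit-inverse ua

  jacobi-* : ∀ {a b} → Unit n a → Unit n b → jacobi (a * b) ≡ jacobi a ℙ.+ jacobi b
  jacobi-* {a} {b} ua ub = begin
    ∑[ i < N ] σ (a * b * + ι i)                                 ≡⟨ sum-cong-≗ step ⟩
    ∑[ i < N ] (σ (a * + ι (π ub i)) ℙ.+ σ (b * + ι i))          ≡⟨ ∑-distrib-+ {N} _ _ ⟩
    ∑[ i < N ] σ (a * + ι (π ub i)) ℙ.+ ∑[ i < N ] σ (b * + ι i) ≡⟨ cong (ℙ._+ _) (∑-reindex ub (λ i → σ (a * + ι i))) ⟨
    jacobi a ℙ.+ jacobi b                                        ∎
    where
    open ≡-Reasoning
    eq : ∀ a b s t x y z → a * b * x - t * s * z ≡ a * (b * x - s * y) + s * (a * y - t * z)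
    eq = solve-∀
    step : ∀ i → σ (a * b * + ι i) ≡ σ (a * + ι (π ub i)) ℙ.+ σ (b * + ι i)
    step i = σ-unique {a * b * + ι i} (t ℙ.+ s) (π ua (π ub i))
      (≡mod-lin₂ a (sgn s) (trans (cong (λ e → a * b * + ι i - e * + ι (π ua (π ub i))) (sgn-+ t s))
                              (eq a b (sgn s) (sgn t) _ (+ ι (π ub i)) _))
        (π-spec ub i) (π-spec ua (π ub i)))
      where
      s = σ (b * + ι i)
      t = σ (a * + ι (π ub i))

  jacobi-cong : ∀ {a b} → Unit n a → a ≡[ n ] b → jacobi a ≡ jacobi b
  jacobi-cong {a} {b} ua a≡b = sum-cong-≗ λ i →
    sym (σ-unique (σ (a * + ι i)) (π ua i) (≡mod-trans (*-cong-mod (≡mod-sym a≡b) (≡mod-refl {n} {+ ι i})) (π-spec ua i)))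

  jacobi-square : ∀ {a} → Unit n a → jacobi (a * a) ≡ 0ℙ
  jacobi-square {a} ua = trans (jacobi-* ua ua) (ℙ.p+p≡0ℙ (jacobi a))

  ∑-1ℙ : ∀ m → ∑[ i < m ] 1ℙ ≡ parity m
  ∑-1ℙ zero    = refl
  ∑-1ℙ (suc m) = trans (cong (1ℙ ℙ.+_) (∑-1ℙ m)) (sym (parity-suc m))

  jacobi--1 : jacobi -1ℤ ≡ parity N
  jacobi--1 = trans (sum-cong-≗ λ i → σ-unique 1ℙ i ≡mod-refl) (∑-1ℙ N)

  -- Compare a k = n ⌊a k / n⌋ + r modulo 2 and sum over k; r is, up to
  -- the sign counted by the Jacobi symbol, a permutation of the k's.
  jacobi-parity : ∀ {a : ℕ} → Unit n (+ a) →
    parity a ℙ.* ∑[ i < N ] parity (ι i) ≡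
    ∑[ i < N ] parity (a ℕ.* ι i ℕ./ n) ℙ.+ ∑[ i < N ] parity (ι i) ℙ.+ jacobi (+ a)
  jacobi-parity {a} ua = begin
    parity a ℙ.* ∑[ i < N ] parity (ι i)        ≡⟨ ∑-scale (λ i → parity (ι i)) ⟩
    ∑[ i < N ] (parity a ℙ.* parity (ι i))      ≡⟨ sum-cong-≗ (λ i → step i) ⟩
    ∑[ i < N ] (F i ℙ.+ parity (ι (π ua i)) ℙ.+ σ (+ a * + ι i)) ≡⟨ ∑-distrib-+ {N} _ _ ⟩
    ∑[ i < N ] (F i ℙ.+ parity (ι (π ua i))) ℙ.+ jacobi (+ a)     ≡⟨ cong (ℙ._+ jacobi (+ a)) (∑-distrib-+ F _) ⟩
    ∑[ i < N ] F i ℙ.+ ∑[ i < N ] parity (ι (π ua i)) ℙ.+ jacobi (+ a)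
      ≡⟨ cong (λ e → ∑[ i < N ] F i ℙ.+ e ℙ.+ jacobi (+ a)) (∑-reindex ua (λ i → parity (ι i))) ⟨
    ∑[ i < N ] F i ℙ.+ ∑[ i < N ] parity (ι i) ℙ.+ jacobi (+ a)  ∎
    where
    open ≡-Reasoning
    F : Fin N → Parity
    F i = parity (a ℕ.* ι i ℕ./ n)
    ∑-scale : ∀ {m} (f : Fin m → Parity) → parity a ℙ.* ∑[ i < m ] f i ≡ ∑[ i < m ] (parity a ℙ.* f i)
    ∑-scale {zero}  f = ℙ.*-zeroʳ (parity a)
    ∑-scale {suc m} f = trans (ℙ.*-distribˡ-+ (parity a) _ _) (cong (parity a ℙ.* f Fin.zero ℙ.+_) (∑-scale (λ i → f (Fin.suc i))))
    step : ∀ i → parity a ℙ.* parity (ι i) ≡ F i ℙ.+ parity (ι (π ua i)) ℙ.+ σ (+ a * + ι i)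
    step i = main (reflect r 1≤r (ℕ.m%n<n (a ℕ.* ι i) n))
      where
      r = a ℕ.* ι i ℕ.% n
      1≤r : 1 ℕ.≤ r
      1≤r = ℕ.n≢0⇒n>0 λ r≡0 → ι∤ ua i (subst (+ n ∣_) (ℤ.pos-* a (ι i)) (∣ᵤ⇒∣ (ℕ.m%n≡0⇒n∣m (a ℕ.* ι i) n r≡0)))
      r-eq : (+ a * + ι i) %ℕ n ≡ r
      r-eq = cong (_%ℕ n) (sym (ℤ.pos-* a (ι i)))
      main : ∃[ j ] (+ r ≡[ n ] sgn (upper r) * + ι j × parity r ≡ parity (ι j) ℙ.+ upper r) → _
      main (j , r≡ , pr) = begin
        parity a ℙ.* parity (ι i)                       ≡⟨ ℙ.*-homo-* a (ι i) ⟨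
        parity (a ℕ.* ι i)                              ≡⟨ cong parity (ℕ.m≡m%n+[m/n]*n (a ℕ.* ι i) n) ⟩
        parity (r ℕ.+ q ℕ.* n)                          ≡⟨ ℙ.+-homo-+ r _ ⟩
        parity r ℙ.+ parity (q ℕ.* n)                   ≡⟨ cong₂ ℙ._+_ pr (ℙ.*-homo-* q n) ⟩
        (parity (ι j) ℙ.+ upper r) ℙ.+ (F i ℙ.* parity n) ≡⟨ cong (λ e → (parity (ι j) ℙ.+ upper r) ℙ.+ (F i ℙ.* e)) n-odd ⟩
        (parity (ι j) ℙ.+ upper r) ℙ.+ (F i ℙ.* 1ℙ)       ≡⟨ cong ((parity (ι j) ℙ.+ upper r) ℙ.+_) (ℙ.*-identityʳ (F i)) ⟩
        (parity (ι j) ℙ.+ upper r) ℙ.+ F i                ≡⟨ ℙ.+-comm _ (F i) ⟩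
        F i ℙ.+ (parity (ι j) ℙ.+ upper r)                ≡⟨ ℙ.+-assoc (F i) _ _ ⟨
        F i ℙ.+ parity (ι j) ℙ.+ upper r                ≡⟨ cong (F i ℙ.+ parity (ι j) ℙ.+_) (cong upper r-eq) ⟨
        F i ℙ.+ parity (ι j) ℙ.+ σ (+ a * + ι i)        ≡⟨ cong (λ e → F i ℙ.+ parity (ι e) ℙ.+ σ (+ a * + ι i)) j≡ ⟩
        F i ℙ.+ parity (ι (π ua i)) ℙ.+ σ (+ a * + ι i) ∎
        where
        q = a ℕ.* ι i ℕ./ n
        n-odd : parity n ≡ 1ℙ
        n-odd = trans (parity-suc (2 ℕ.* N)) (cong (1ℙ ℙ.+_) (parity-2* N))
        ai≡r : + a * + ι i ≡[ n ] + r
        ai≡r = subst (λ e → + a * + ι i ≡[ n ] + e) r-eq (%ℕ-mod (+ a * + ι i) n)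
        j≡ : j ≡ π ua i
        j≡ = proj₂ (residue-unique (upper r) (σ (+ a * + ι i)) j (π ua i)
               (≡mod-trans (≡mod-sym (≡mod-trans ai≡r r≡)) (π-spec ua i)))

  ∑-ι : ∑[ i < N ] parity (ι i) ≡ triangular N
  ∑-ι = go N
    where
    go : ∀ m → ∑[ i < m ] parity (suc (toℕ i)) ≡ triangular m
    go zero    = refl
    go (suc m) = trans (sum-init-last (λ (i : Fin (suc m)) → parity (suc (toℕ i))))
      (cong₂ ℙ._+_ (trans (sum-cong-≗ {m} λ i → cong (λ e → parity (suc e)) (Fin.toℕ-inject₁ i)) (go m))
                   (cong (λ e → parity (suc e)) (Fin.toℕ-fromℕ m)))

  unit-2 : Unit n (+ 2)
  unit-2 = unit (+ suc N) $ congruent (divides 1ℤ (trans (cong (_- 1ℤ) (sym (ℤ.pos-* 2 (suc N))))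
    (cong (λ e → + e) (trans (ℕ.+-suc N _) (sym (ℕ.+-identityʳ n))))))

  jacobi-2 : jacobi (+ 2) ≡ triangular N
  jacobi-2 = sym (cancel _ _ (trans (jacobi-parity unit-2) (cong₂ (λ x y → x ℙ.+ y ℙ.+ jacobi (+ 2)) no-quotient ∑-ι)))
    where
    cancel : ∀ t j → 0ℙ ≡ 0ℙ ℙ.+ t ℙ.+ j → t ≡ j
    cancel 0ℙ 0ℙ _ = refl
    cancel 1ℙ 1ℙ _ = refl
    no-quotient : ∑[ i < N ] parity (2 ℕ.* ι i ℕ./ n) ≡ 0ℙ
    no-quotient = trans (sum-cong-≗ λ i → cong parity (ℕ.m<n⇒m/n≡0 {2 ℕ.* ι i} {n} (ℕ.s≤s (ℕ.*-monoʳ-≤ 2 (ι≤N i)))))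
                        (sum-replicate-zero N)

  jacobi-odd : ∀ {M} → Unit n (+ suc (2 ℕ.* M)) →
               jacobi (+ suc (2 ℕ.* M)) ≡ ∑[ i < N ] parity (suc (2 ℕ.* M) ℕ.* ι i ℕ./ n)
  jacobi-odd {M} ua = cancel _ _ _ (trans (cong (ℙ._* ∑[ i < N ] parity (ι i)) (sym m-odd)) (jacobi-parity ua))
    where
    m-odd : parity (suc (2 ℕ.* M)) ≡ 1ℙ
    m-odd = trans (parity-suc (2 ℕ.* M)) (cong (1ℙ ℙ.+_) (parity-2* M))
    cancel : ∀ f t j → 1ℙ ℙ.* t ≡ f ℙ.+ t ℙ.+ j → j ≡ f
    cancel 0ℙ 0ℙ 0ℙ _ = refl
    cancel 0ℙ 1ℙ 0ℙ _ = refl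
    cancel 1ℙ 0ℙ 1ℙ _ = refl
    cancel 1ℙ 1ℙ 1ℙ _ = refl

𝟙 : Bool → Parity
𝟙 true  = 1ℙ
𝟙 false = 0ℙ

∑-initial : ∀ m {f} → f ℕ.≤ m → ∑[ l < m ] 𝟙 (toℕ l ℕ.<ᵇ f) ≡ parity f
∑-initial zero    ℕ.z≤n           = refl
∑-initial (suc m) ℕ.z≤n           = sum-replicate-zero (suc m)
∑-initial (suc m) (ℕ.s≤s {f} f≤m) = trans (cong (1ℙ ℙ.+_) (∑-initial m f≤m)) (sym (parity-suc f))

∑-const : ∀ m {c} → ∑[ i < m ] c ≡ parity m ℙ.* c
∑-const zero        = refl
∑-const (suc m) {c} = trans (cong (c ℙ.+_) (∑-const m))
  (trans (eq c (parity m)) (cong (ℙ._* c) (sym (parity-suc m))))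
  where
  eq : ∀ c p → c ℙ.+ (p ℙ.* c) ≡ (1ℙ ℙ.+ p) ℙ.* c
  eq 0ℙ 0ℙ = refl
  eq 0ℙ 1ℙ = refl
  eq 1ℙ 0ℙ = refl
  eq 1ℙ 1ℙ = refl

-- ⌊m k / n⌋ counts the 1 ≤ l ≤ M with n l ≤ m k
∑-quotient : ∀ M N (i : Fin N) → let m = suc (2 ℕ.* M) ; n = suc (2 ℕ.* N) in
  parity (m ℕ.* suc (toℕ i) ℕ./ n) ≡ ∑[ l < M ] 𝟙 (n ℕ.* suc (toℕ l) ℕ.≤ᵇ m ℕ.* suc (toℕ i))
∑-quotient M N i = trans (sym (∑-initial M F≤M)) (sum-cong-≗ λ l → cong 𝟙 (≤ᵇ-cong (to l) (from l)))
  where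
  m = suc (2 ℕ.* M)
  n = suc (2 ℕ.* N)
  k = suc (toℕ i)
  F = m ℕ.* k ℕ./ n
  F≤M : F ℕ.≤ M
  F≤M = ℕ.≤-pred (ℕ.m<n*o⇒m/o<n (ℕ.≤-<-trans (ℕ.*-monoʳ-≤ m (Fin.toℕ<n i)) mN<))
    where
    mN< : m ℕ.* N ℕ.< suc M ℕ.* n
    mN< = subst (m ℕ.* N ℕ.<_) (eq M N) (ℕ.s≤s (ℕ.m≤m+n (m ℕ.* N) (M ℕ.+ N)))
      where
      eq : ∀ M N → suc (suc (2 ℕ.* M) ℕ.* N ℕ.+ (M ℕ.+ N)) ≡ suc M ℕ.* suc (2 ℕ.* N)
      eq = ℕ-Ring.solve-∀
  to : ∀ (l : Fin M) → suc (toℕ l) ℕ.≤ F → n ℕ.* suc (toℕ l) ℕ.≤ m ℕ.* k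
  to l l≤F = ℕ.≤-trans (ℕ.*-monoʳ-≤ n l≤F) (ℕ.≤-trans (ℕ.≤-reflexive (ℕ.*-comm n F)) (ℕ.m/n*n≤m (m ℕ.* k) n))
  from : ∀ (l : Fin M) → n ℕ.* suc (toℕ l) ℕ.≤ m ℕ.* k → suc (toℕ l) ℕ.≤ F
  from l nl≤ = subst (ℕ._≤ F) (trans (cong (ℕ._/ n) (ℕ.*-comm n (suc (toℕ l)))) (ℕ.m*n/n≡m (suc (toℕ l)) n)) (ℕ./-monoˡ-≤ n nl≤)
  ≤ᵇ-cong : ∀ {a b c d} → (a ℕ.≤ b → c ℕ.≤ d) → (c ℕ.≤ d → a ℕ.≤ b) → (a ℕ.≤ᵇ b) ≡ (c ℕ.≤ᵇ d)
  ≤ᵇ-cong {a} {b} {c} {d} f g with a ℕ.≤ᵇ b in e₁ | c ℕ.≤ᵇ d in e₂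
  ... | false | false = refl
  ... | true  | true  = refl
  ... | true  | false = contradiction (subst Bool.T e₂ (ℕ.≤⇒≤ᵇ (f (ℕ.≤ᵇ⇒≤ a b (subst Bool.T (sym e₁) _))))) λ ()
  ... | false | true  = contradiction (subst Bool.T e₁ (ℕ.≤⇒≤ᵇ (g (ℕ.≤ᵇ⇒≤ c d (subst Bool.T (sym e₂) _))))) λ ()

reciprocity : ∀ M N → let m = suc (2 ℕ.* M) ; n = suc (2 ℕ.* N) in
  Unit n (+ m) → Unit m (+ n) → Gauss.jacobi N (+ m) ℙ.+ Gauss.jacobi M (+ n) ≡ parity M ℙ.* parity N
reciprocity M N um un = begin
  Gauss.jacobi N (+ m) ℙ.+ Gauss.jacobi M (+ n)
    ≡⟨ cong₂ ℙ._+_ (Gauss.jacobi-odd N {M} um) (Gauss.jacobi-odd M {N} un) ⟩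
  ∑[ k < N ] parity (m ℕ.* suc (toℕ k) ℕ./ n) ℙ.+ ∑[ l < M ] parity (n ℕ.* suc (toℕ l) ℕ./ m)
    ≡⟨ cong₂ ℙ._+_ (sum-cong-≗ (∑-quotient M N)) (sum-cong-≗ (∑-quotient N M)) ⟩
  ∑[ k < N ] ∑[ l < M ] below l k ℙ.+ ∑[ l < M ] ∑[ k < N ] above l k
    ≡⟨ cong (ℙ._+ ∑[ l < M ] ∑[ k < N ] above l k) (∑-comm (λ k l → below l k)) ⟩
  ∑[ l < M ] ∑[ k < N ] below l k ℙ.+ ∑[ l < M ] ∑[ k < N ] above l k
    ≡⟨ ∑-distrib-+ {M} _ _ ⟨
  ∑[ l < M ] (∑[ k < N ] below l k ℙ.+ ∑[ k < N ] above l k)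
    ≡⟨ sum-cong-≗ {M} (λ l → sym (∑-distrib-+ {N} _ _)) ⟩
  ∑[ l < M ] ∑[ k < N ] (below l k ℙ.+ above l k)
    ≡⟨ sum-cong-≗ {M} (λ l → sum-cong-≗ {N} (λ k → off-diagonal l k)) ⟩
  ∑[ l < M ] ∑[ k < N ] 1ℙ
    ≡⟨ sum-cong-≗ {M} (λ l → trans (∑-const N) (ℙ.*-identityʳ _)) ⟩
  ∑[ l < M ] parity N
    ≡⟨ ∑-const M ⟩
  parity M ℙ.* parity N ∎
  where
  open ≡-Reasoning
  m = suc (2 ℕ.* M)
  n = suc (2 ℕ.* N)
  below above : Fin M → Fin N → Parity
  below l k = 𝟙 (n ℕ.* suc (toℕ l) ℕ.≤ᵇ m ℕ.* suc (toℕ k))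
  above l k = 𝟙 (m ℕ.* suc (toℕ k) ℕ.≤ᵇ n ℕ.* suc (toℕ l))
  exactly-one : ∀ {a b} → a ≢ b → 𝟙 (a ℕ.≤ᵇ b) ℙ.+ 𝟙 (b ℕ.≤ᵇ a) ≡ 1ℙ
  exactly-one {a} {b} a≢b with a ℕ.≤ᵇ b in e₁ | b ℕ.≤ᵇ a in e₂
  ... | true  | false = refl
  ... | false | true  = refl
  ... | true  | true  = contradiction
    (ℕ.≤-antisym (ℕ.≤ᵇ⇒≤ a b (subst Bool.T (sym e₁) _)) (ℕ.≤ᵇ⇒≤ b a (subst Bool.T (sym e₂) _))) a≢b
  ... | false | false with ℕ.≤-total a b
  ...   | inj₁ a≤b = contradiction (subst Bool.T e₁ (ℕ.≤⇒≤ᵇ a≤b)) λ ()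
  ...   | inj₂ b≤a = contradiction (subst Bool.T e₂ (ℕ.≤⇒≤ᵇ b≤a)) λ ()
  off-diagonal : ∀ l k → below l k ℙ.+ above l k ≡ 1ℙ
  off-diagonal l k = exactly-one λ nl≡mk →
    Gauss.ι∤ N um k (subst (+ n ∣_) (ℤ.pos-* m (suc (toℕ k))) (∣ᵤ⇒∣ (subst (n ℕ.∣_) nl≡mk (ℕ.m∣m*n (suc (toℕ l))))))

-- Square classes over ℚ₂

record Odd (n : ℕ) : Set where
  constructor odd
  field
    parity≡1 : parity n ≡ 1ℙ

odd-form : ∀ {n} → Odd n → n ≡ suc (2 ℕ.* ⌊ n /2⌋)
odd-form {suc zero}    _ = refl
odd-form {suc (suc n)} (odd o) = trans (cong (λ e → suc (suc e)) (odd-form (odd o))) (eq ⌊ n /2⌋)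
  where
  eq : ∀ h → suc (suc (suc (2 ℕ.* h))) ≡ suc (2 ℕ.* suc h)
  eq = ℕ-Ring.solve-∀

odd-suc-2* : ∀ N → Odd (suc (2 ℕ.* N))
odd-suc-2* N = odd $ trans (parity-suc (2 ℕ.* N)) (cong (1ℙ ℙ.+_) (parity-2* N))

half-odd : ∀ N → ⌊ suc (2 ℕ.* N) /2⌋ ≡ N
half-odd zero    = refl
half-odd (suc N) = trans (cong ⌊_/2⌋ (eq N)) (cong suc (half-odd N))
  where
  eq : ∀ N → suc (2 ℕ.* suc N) ≡ suc (suc (suc (2 ℕ.* N)))
  eq = ℕ-Ring.solve-∀

odd-* : ∀ {m n} → Odd m → Odd n → Odd (m ℕ.* n)
odd-* {m} {n} (odd om) (odd on) = odd $ trans (ℙ.*-homo-* m n) (cong₂ ℙ._*_ om on)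

odd-factors : ∀ m n → Odd (m ℕ.* n) → Odd m × Odd n
odd-factors m n (odd o) =
  let p , q = factors (parity m) (parity n) (trans (sym (ℙ.*-homo-* m n)) o) in odd p , odd q
  where
  factors : ∀ p q → p ℙ.* q ≡ 1ℙ → p ≡ 1ℙ × q ≡ 1ℙ
  factors 1ℙ 1ℙ _ = refl , refl

odd-nonZero : ∀ {n} → Odd n → NonZero n
odd-nonZero {suc n} _ = _
odd-nonZero {zero}  (odd ())

-- The two quadratic characters of conductor 4 and 8, written additively.
χ₄ χ₈ : ℕ → Parity
χ₄ A = parity ⌊ A /2⌋
χ₈ A = triangular ⌊ A /2⌋

triangular-+ : ∀ m n → triangular (m ℕ.+ n) ≡ triangular m ℙ.+ triangular n ℙ.+ (parity m ℙ.* parity n)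
triangular-+ zero    n = sym (ℙ.+-identityʳ _)
triangular-+ (suc m) n = begin
  triangular (m ℕ.+ n) ℙ.+ parity (suc (m ℕ.+ n))
    ≡⟨ cong₂ ℙ._+_ (triangular-+ m n) (trans (parity-suc (m ℕ.+ n)) (cong (1ℙ ℙ.+_) (ℙ.+-homo-+ m n))) ⟩
  triangular m ℙ.+ triangular n ℙ.+ (parity m ℙ.* parity n) ℙ.+ (1ℙ ℙ.+ (parity m ℙ.+ parity n))
    ≡⟨ eq (triangular m) (triangular n) (parity m) (parity n) ⟩
  triangular m ℙ.+ (1ℙ ℙ.+ parity m) ℙ.+ triangular n ℙ.+ ((1ℙ ℙ.+ parity m) ℙ.* parity n)
    ≡⟨ cong (λ e → triangular m ℙ.+ e ℙ.+ triangular n ℙ.+ (e ℙ.* parity n)) (parity-suc m) ⟨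
  triangular m ℙ.+ parity (suc m) ℙ.+ triangular n ℙ.+ (parity (suc m) ℙ.* parity n) ∎
  where
  open ≡-Reasoning
  open ℙ-Solver
  eq : ∀ s t p q → s ℙ.+ t ℙ.+ (p ℙ.* q) ℙ.+ (1ℙ ℙ.+ (p ℙ.+ q)) ≡ s ℙ.+ (1ℙ ℙ.+ p) ℙ.+ t ℙ.+ ((1ℙ ℙ.+ p) ℙ.* q)
  eq = solve 4 (λ s t p q → s :+ t :+ (p :* q) :+ (con 1ℙ :+ (p :+ q)) :=
                            s :+ (con 1ℙ :+ p) :+ t :+ ((con 1ℙ :+ p) :* q)) refl

triangular-2* : ∀ n → triangular (2 ℕ.* n) ≡ parity n
triangular-2* n = begin
  triangular (n ℕ.+ (n ℕ.+ 0))                         ≡⟨ cong (λ e → triangular (n ℕ.+ e)) (ℕ.+-identityʳ n) ⟩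
  triangular (n ℕ.+ n)                                 ≡⟨ triangular-+ n n ⟩
  triangular n ℙ.+ triangular n ℙ.+ (parity n ℙ.* parity n) ≡⟨ eq (triangular n) (parity n) ⟩
  parity n                                             ∎
  where
  open ≡-Reasoning
  eq : ∀ t p → t ℙ.+ t ℙ.+ (p ℙ.* p) ≡ p
  eq 0ℙ 0ℙ = refl
  eq 0ℙ 1ℙ = refl
  eq 1ℙ 0ℙ = refl
  eq 1ℙ 1ℙ = refl

module _ {A B : ℕ} (oA : Odd A) (oB : Odd B) where

  private
    M = ⌊ A /2⌋
    N = ⌊ B /2⌋

    half-* : ⌊ A ℕ.* B /2⌋ ≡ 2 ℕ.* (M ℕ.* N) ℕ.+ (M ℕ.+ N)
    half-* = trans (cong ⌊_/2⌋ (trans (cong₂ ℕ._*_ (odd-form oA) (odd-form oB)) (eq M N))) (half-odd _)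
      where
      eq : ∀ M N → suc (2 ℕ.* M) ℕ.* suc (2 ℕ.* N) ≡ suc (2 ℕ.* (2 ℕ.* (M ℕ.* N) ℕ.+ (M ℕ.+ N)))
      eq = ℕ-Ring.solve-∀

  χ₄-* : χ₄ (A ℕ.* B) ≡ χ₄ A ℙ.+ χ₄ B
  χ₄-* = begin
    parity ⌊ A ℕ.* B /2⌋                           ≡⟨ cong parity half-* ⟩
    parity (2 ℕ.* (M ℕ.* N) ℕ.+ (M ℕ.+ N))         ≡⟨ ℙ.+-homo-+ (2 ℕ.* (M ℕ.* N)) (M ℕ.+ N) ⟩
    parity (2 ℕ.* (M ℕ.* N)) ℙ.+ parity (M ℕ.+ N)  ≡⟨ cong₂ ℙ._+_ (parity-2* (M ℕ.* N)) (ℙ.+-homo-+ M N) ⟩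
    χ₄ A ℙ.+ χ₄ B                                  ∎
    where open ≡-Reasoning

  χ₈-* : χ₈ (A ℕ.* B) ≡ χ₈ A ℙ.+ χ₈ B
  χ₈-* = begin
    triangular ⌊ A ℕ.* B /2⌋
      ≡⟨ cong triangular half-* ⟩
    triangular (2 ℕ.* (M ℕ.* N) ℕ.+ (M ℕ.+ N))
      ≡⟨ triangular-+ (2 ℕ.* (M ℕ.* N)) (M ℕ.+ N) ⟩
    triangular (2 ℕ.* (M ℕ.* N)) ℙ.+ triangular (M ℕ.+ N) ℙ.+ (parity (2 ℕ.* (M ℕ.* N)) ℙ.* parity (M ℕ.+ N))
      ≡⟨ cong₂ (λ e f → e ℙ.+ triangular (M ℕ.+ N) ℙ.+ (f ℙ.* parity (M ℕ.+ N)))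
               (trans (triangular-2* (M ℕ.* N)) (ℙ.*-homo-* M N)) (parity-2* (M ℕ.* N)) ⟩
    (parity M ℙ.* parity N) ℙ.+ triangular (M ℕ.+ N) ℙ.+ 0ℙ
      ≡⟨ cong (λ e → (parity M ℙ.* parity N) ℙ.+ e ℙ.+ 0ℙ) (triangular-+ M N) ⟩
    (parity M ℙ.* parity N) ℙ.+ (triangular M ℙ.+ triangular N ℙ.+ (parity M ℙ.* parity N)) ℙ.+ 0ℙ
      ≡⟨ eq (parity M ℙ.* parity N) (triangular M) (triangular N) ⟩
    χ₈ A ℙ.+ χ₈ B ∎
    where
    open ≡-Reasoning
    open ℙ-Solver
    eq : ∀ p s t → p ℙ.+ (s ℙ.+ t ℙ.+ p) ℙ.+ 0ℙ ≡ s ℙ.+ t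
    eq = solve 3 (λ p s t → p :+ (s :+ t :+ p) :+ con 0ℙ := s :+ t) refl

-- The square class of 2 ^ i A in ℚ₂, for A odd.
record Class : Set where
  constructor class
  field
    ord c₄ c₈ : Parity

squareClass : ℕ → ℕ → Class
squareClass i A = class (parity i) (χ₄ A) (χ₈ A)

-- 1ℙ exactly when the diagonal form with coefficients in the given classes is isotropic over ℚ₂.
isotropy : Class → Class → Class → Parity
isotropy (class i a a′) (class j b b′) (class k c c′) =
  (a ℙ.+ b ℙ.+ c ℙ.+ (a ℙ.* b) ℙ.+ (b ℙ.* c) ℙ.+ (c ℙ.* a)) ℙ.+
  (((j ℙ.+ k) ℙ.* a′) ℙ.+ ((k ℙ.+ i) ℙ.* b′) ℙ.+ ((i ℙ.+ j) ℙ.* c′))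

isotropy-rotate : ∀ x y z → isotropy y z x ≡ isotropy x y z
isotropy-rotate (class i a a′) (class j b b′) (class k c c′) =
  solve 9 (λ i a a′ j b b′ k c c′ →
    (b :+ c :+ a :+ (b :* c) :+ (c :* a) :+ (a :* b)) :+
    (((k :+ i) :* b′) :+ ((i :+ j) :* c′) :+ ((j :+ k) :* a′)) :=
    (a :+ b :+ c :+ (a :* b) :+ (b :* c) :+ (c :* a)) :+
    (((j :+ k) :* a′) :+ ((k :+ i) :* b′) :+ ((i :+ j) :* c′))) refl i a a′ j b b′ k c c′
  where open ℙ-Solver

scale : Class → Class → Class
scale (class i a a′) (class j b b′) = class (i ℙ.+ j) (a ℙ.+ b) (a′ ℙ.+ b′)

-- The forms g x² , g y² , z² and x² , y² , g z² are proportional up to squares.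
isotropy-scale : ∀ s s′ x y z → let g = class 0ℙ s s′ in
                 isotropy (scale g x) (scale g y) z ≡ isotropy x y (scale g z)
isotropy-scale s s′ (class i a a′) (class j b b′) (class k c c′) = cong₂ ℙ._+_
  (trans
    (solve 4 (λ s a b c →
      (s :+ a) :+ (s :+ b) :+ c :+ ((s :+ a) :* (s :+ b)) :+ ((s :+ b) :* c) :+ (c :* (s :+ a)) :=
      a :+ b :+ c :+ (s :* s) :+ (a :* b) :+ (b :* s) :+ (s :* a) :+ (b :* c) :+ (c :* a)) refl s a b c)
    (trans (cong (λ e → a ℙ.+ b ℙ.+ c ℙ.+ e ℙ.+ (a ℙ.* b) ℙ.+ (b ℙ.* s) ℙ.+ (s ℙ.* a) ℙ.+ (b ℙ.* c) ℙ.+ (c ℙ.* a)) (idem s))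
      (solve 4 (λ s a b c →
        a :+ b :+ c :+ s :+ (a :* b) :+ (b :* s) :+ (s :* a) :+ (b :* c) :+ (c :* a) :=
        a :+ b :+ (s :+ c) :+ (a :* b) :+ (b :* (s :+ c)) :+ ((s :+ c) :* a)) refl s a b c)))
  (solve 7 (λ s i j k a b c →
    ((j :+ k) :* (s :+ a)) :+ ((k :+ i) :* (s :+ b)) :+ ((i :+ j) :* c) :=
    ((j :+ k) :* a) :+ ((k :+ i) :* b) :+ ((i :+ j) :* (s :+ c))) refl s′ i j k a′ b′ c′)
  where
  open ℙ-Solver
  idem : ∀ p → p ℙ.* p ≡ p
  idem 0ℙ = refl
  idem 1ℙ = refl

-- Forms representing every residue to odd moduli

value : (α β γ x y z : ℤ) → ℤ
value α β γ x y z = α * (x * x) + β * (y * y) + γ * (z * z)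

record OddUniversal (α β γ : ℤ) : Set where
  constructor oddUniversal
  field
    represent : ∀ m → Odd m → ∀ r → ∃[ x ] ∃[ y ] ∃[ z ] value α β γ x y z ≡[ m ] r

open OddUniversal

rotate : ∀ {α β γ} → OddUniversal α β γ → OddUniversal β γ α
rotate {α} {β} {γ} U = oddUniversal λ m om r → let x , y , z , e = represent U m om r in
  y , z , x , subst (_≡[ m ] r) (eq α β γ x y z) e
  where
  eq : ∀ α β γ x y z → α * (x * x) + β * (y * y) + γ * (z * z) ≡ β * (y * y) + γ * (z * z) + α * (x * x)
  eq = solve-∀

remove-square : ∀ d {α β γ} → OddUniversal (d * d * α) β γ → OddUniversal α β γ
remove-square d {α} {β} {γ} U = oddUniversal λ m om r → let x , y , z , e = represent U m om r in
  d * x , y , z , subst (_≡[ m ] r) (eq d α β γ x y z) e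
  where
  eq : ∀ d α β γ x y z → d * d * α * (x * x) + β * (y * y) + γ * (z * z) ≡
                         α * (d * x * (d * x)) + β * (y * y) + γ * (z * z)
  eq = solve-∀

SquareFree : ℕ → Set
SquareFree n = ∀ d → d ℕ.* d ℕ.∣ n → d ≡ 1

squareFree-∣ : ∀ {m n} → m ℕ.∣ n → SquareFree n → SquareFree m
squareFree-∣ m∣n sf d dd∣m = sf d (ℕ.∣-trans dd∣m m∣n)

squareFree-root : ∀ {g} .{{_ : NonZero g}} z → SquareFree g → g ℕ.∣ z ℕ.* z → g ℕ.∣ z
squareFree-root {g} z sf g∣zz = subst (ℕ._∣ z) e≡g (ℕ.gcd[m,n]∣n g z)
  where
  e = gcd g z
  instance
    e≢0 : NonZero e
    e≢0 = ℕ.≢-nonZero (ℕ.gcd[m,n]≢0 g z (inj₁ (ℕ.≢-nonZero⁻¹ g)))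
  g₁ = g ℕ./ e
  z₁ = z ℕ./ e
  g≡ : g₁ ℕ.* e ≡ g
  g≡ = ℕ.m/n*n≡m (ℕ.gcd[m,n]∣m g z)
  z≡ : z₁ ℕ.* e ≡ z
  z≡ = ℕ.m/n*n≡m (ℕ.gcd[m,n]∣n g z)
  coprime : Coprime g₁ z₁
  coprime = ℕ.coprime-/gcd g z
  g₁∣ : g₁ ℕ.∣ z₁ ℕ.* (z₁ ℕ.* e)
  g₁∣ = ℕ.*-cancelʳ-∣ e (subst₂ ℕ._∣_ (sym g≡)
          (trans (cong₂ ℕ._*_ (sym z≡) (sym z≡)) (eq z₁ e)) g∣zz)
    where
    eq : ∀ z e → z ℕ.* e ℕ.* (z ℕ.* e) ≡ z ℕ.* (z ℕ.* e) ℕ.* e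
    eq = ℕ-Ring.solve-∀
  g₁∣e : g₁ ℕ.∣ e
  g₁∣e = ℕ.coprime-divisor coprime (ℕ.coprime-divisor coprime g₁∣)
  e≡g : e ≡ g
  e≡g = trans (sym (ℕ.*-identityˡ e)) (trans (cong (ℕ._* e) (sym (sf g₁ (subst (g₁ ℕ.* g₁ ℕ.∣_) g≡ (ℕ.*-monoʳ-∣ g₁ g₁∣e))))) g≡)

coprime-unit⁺ : ∀ {n a} → Coprime n a → Unit n (+ a)
coprime-unit⁺ {n} {a} c with coprime-Bézout c
... | Bézout.+- x y eq = unit (- + y) $ congruent $ divides (- + x)
        (lemma (+ n) (+ a) (+ x) (+ y)
          (trans (cong (λ e → 1ℤ + e) (sym (ℤ.pos-* y a))) (trans (cong (λ e → + e) eq) (ℤ.pos-* x n))))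
  where
  lemma′ : ∀ n a x y → a * - y - 1ℤ ≡ - (1ℤ + y * a)
  lemma′ = solve-∀
  lemma : ∀ n a x y → 1ℤ + y * a ≡ x * n → a * - y - 1ℤ ≡ - x * n
  lemma n a x y e = trans (lemma′ n a x y) (trans (cong -_ e) (ℤ.neg-distribˡ-* x n))
... | Bézout.-+ x y eq = unit (+ y) $ congruent $ divides (+ x)
        (lemma (+ n) (+ a) (+ x) (+ y)
          (trans (cong (λ e → 1ℤ + e) (sym (ℤ.pos-* x n))) (trans (cong (λ e → + e) eq) (ℤ.pos-* y a))))
  where
  lemma′ : ∀ n x → 1ℤ + x * n - 1ℤ ≡ x * n
  lemma′ = solve-∀
  lemma : ∀ n a x y → 1ℤ + x * n ≡ y * a → a * y - 1ℤ ≡ x * n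
  lemma n a x y e = trans (cong (_- 1ℤ) (trans (ℤ.*-comm a y) (sym e))) (lemma′ n x)

coprime-unit : ∀ {n} a → Coprime n ∣ a ∣ → Unit n a
coprime-unit (+ a)          c = coprime-unit⁺ c
coprime-unit -[1+ a ] c =
  subst (Unit _) (ℤ.-1*i≡-i (+ suc a)) (unit-* unit--1 (coprime-unit⁺ c))

unit-modulus-* : ∀ {g h a} → Unit g a → Unit h a → Unit (g ℕ.* h) a
unit-modulus-* {g} {h} {a} (unit u (congruent (divides q p))) (unit v (congruent (divides q′ p′))) =
  unit (u + v - a * u * v) $ congruent $ divides (- (q * q′)) (begin
    a * (u + v - a * u * v) - 1ℤ    ≡⟨ eq₁ a u v ⟩
    - ((a * u - 1ℤ) * (a * v - 1ℤ)) ≡⟨ cong₂ (λ s t → - (s * t)) p p′ ⟩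
    - (q * + g * (q′ * + h))        ≡⟨ eq₂ q q′ (+ g) (+ h) ⟩
    - (q * q′) * (+ g * + h)        ≡⟨ cong (- (q * q′) *_) (ℤ.pos-* g h) ⟨
    - (q * q′) * + (g ℕ.* h)        ∎)
  where
  open ≡-Reasoning
  eq₁ : ∀ a u v → a * (u + v - a * u * v) - 1ℤ ≡ - ((a * u - 1ℤ) * (a * v - 1ℤ))
  eq₁ = solve-∀
  eq₂ : ∀ q q′ g h → - (q * g * (q′ * h)) ≡ - (q * q′) * (g * h)
  eq₂ = solve-∀

unit-∣ : ∀ {m n a} → m ℕ.∣ n → Unit n a → Unit m a
unit-∣ m∣n (unit u (congruent p)) = unit u (congruent (∣-trans (∣ᵤ⇒∣ m∣n) p))

-- If p A , β , γ represent - p A β γ modulo A², then - β γ is a square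
-- modulo A up to the square of a unit t. Let g be the common
-- part of y and z with A, and A = g h. The equation gives
-- β y² + γ z² ≡ 0 mod h and, after dividing by g², x² + β γ ≡ 0 mod g, and
-- t = g y + h combines the two.
module _ (N : ℕ) where

  open Gauss N using (n; jacobi; jacobi-*; jacobi-cong; jacobi-square)

  module _ {p β γ} (up : Unit n p) (uβ : Unit n β) (uγ : Unit n γ) (sf : SquareFree n) where

    module _ {x y z : ℤ} {g h : ℕ} .{{_ : NonZero g}} (n≡gh : n ≡ g ℕ.* h)
             (g-gcd : g ≡ gcd n ∣ y ∣)
             (e : value (p * + n) β γ x y z ≡[ n ℕ.* n ] - (p * + n * β * γ)) where

      private
        g∣n : g ℕ.∣ n
        g∣n = subst (g ℕ.∣_) (sym n≡gh) (ℕ.m∣m*n h)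

        h∣n : h ℕ.∣ n
        h∣n = subst (h ℕ.∣_) (sym n≡gh) (ℕ.n∣m*n g)

        g∣y : + g ∣ y
        g∣y = ∣ᵤ⇒∣ (subst (ℕ._∣ ∣ y ∣) (sym g-gcd) (ℕ.gcd[m,n]∣n n ∣ y ∣))

        n∣ : + n ∣ β * (y * y) + γ * (z * z)
        n∣ = ∣-lin₂ 1ℤ (- p * (x * x) - p * β * γ) (eq p (+ n) β γ x y z)
               (∣-trans (∣ᵤ⇒∣ (ℕ.m∣m*n n)) (∣-difference e)) ∣-refl
          where
          eq : ∀ p n β γ x y z → β * (y * y) + γ * (z * z) ≡
               1ℤ * (p * n * (x * x) + β * (y * y) + γ * (z * z) - - (p * n * β * γ)) + (- p * (x * x) - p * β * γ) * n
          eq = solve-∀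

        g∣z : + g ∣ z
        g∣z = ∣ᵤ⇒∣ (squareFree-root ∣ z ∣ (squareFree-∣ g∣n sf)
                (subst (g ℕ.∣_) (ℤ.abs-* z z) (∣⇒∣ᵤ (unit-cancel (z * z) (unit-∣ g∣n uγ) g∣γzz))))
          where
          eq : ∀ β γ y z → γ * (z * z) ≡ 1ℤ * (β * (y * y) + γ * (z * z)) + - (β * y) * y
          eq = solve-∀
          g∣γzz : + g ∣ γ * (z * z)
          g∣γzz = ∣-lin₂ 1ℤ (- (β * y)) (eq β γ y z) (∣-trans (∣ᵤ⇒∣ g∣n) n∣) g∣y

        g⊥h : Coprime g h
        g⊥h {d} (d∣g , d∣h) = sf d (subst (d ℕ.* d ℕ.∣_) (sym n≡gh) (ℕ.*-pres-∣ d∣g d∣h))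

        h⊥y : Coprime h ∣ y ∣
        h⊥y {d} (d∣h , d∣y) = g⊥h (subst (d ℕ.∣_) (sym g-gcd) (ℕ.gcd-greatest (ℕ.∣-trans d∣h h∣n) d∣y) , d∣h)

        h-unit : Unit g (+ h)
        h-unit = coprime-unit (+ h) g⊥h

        g-unit : Unit h (+ g)
        g-unit = coprime-unit (+ g) (ℕ.sym g⊥h)

        y-unit : Unit h y
        y-unit = coprime-unit y h⊥y

        g∣xx+βγ : + g ∣ x * x + β * γ
        g∣xx+βγ = unit-cancel _ (unit-* (unit-∣ g∣n up) h-unit)
          (*-cancelˡ-∣ (+ g) (subst (+ g * + g ∣_)
              (trans (cong (λ e → p * e * (x * x + β * γ)) n≡gh′) (eq₂ p (+ g) (+ h) (x * x + β * γ)))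
            (∣-lin₂ 1ℤ -1ℤ (eq₁ p (+ n) β γ x y z) gg∣e gg∣βyy+γzz)))
          where
          n≡gh′ : + n ≡ + g * + h
          n≡gh′ = trans (cong +_ n≡gh) (ℤ.pos-* g h)
          eq₁ : ∀ p n β γ x y z → p * n * (x * x + β * γ) ≡
                1ℤ * (p * n * (x * x) + β * (y * y) + γ * (z * z) - - (p * n * β * γ)) + -1ℤ * (β * (y * y) + γ * (z * z))
          eq₁ = solve-∀
          eq₂ : ∀ p g h s → p * (g * h) * s ≡ g * (p * h * s)
          eq₂ = solve-∀
          gg∣e : + g * + g ∣ value (p * + n) β γ x y z - - (p * + n * β * γ)
          gg∣e = ∣-trans (subst (_∣ + (n ℕ.* n)) (ℤ.pos-* g g) (∣ᵤ⇒∣ (ℕ.*-pres-∣ g∣n g∣n))) (∣-difference e)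
          sq : ∀ {w} → + g ∣ w → + g * + g ∣ w * w
          sq {w} (divides q refl) = divides (q * q) (eq q (+ g))
            where
            eq : ∀ q g → q * g * (q * g) ≡ q * q * (g * g)
            eq = solve-∀
          gg∣βyy+γzz : + g * + g ∣ β * (y * y) + γ * (z * z)
          gg∣βyy+γzz = ∣-lin₂ β γ refl (sq g∣y) (sq g∣z)

        s t : ℤ
        s = + g * γ * z + + h * x
        t = + g * y + + h

        t-unit : Unit n t
        t-unit = subst (λ m → Unit m t) (sym n≡gh) (unit-modulus-*
          (unit-cong (≡mod-lin₁ (- y) (eq₁ (+ g) (+ h) y) (∣⇒≡0 ∣-refl)) h-unit)
          (unit-cong (≡mod-lin₁ -1ℤ (eq₂ (+ g) (+ h) y) (∣⇒≡0 ∣-refl)) (unit-* g-unit y-unit)))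
          where
          eq₁ : ∀ g h y → h - (g * y + h) ≡ - y * (g - + 0)
          eq₁ = solve-∀
          eq₂ : ∀ g h y → g * y - (g * y + h) ≡ -1ℤ * (h - + 0)
          eq₂ = solve-∀

        -βγtt≡ss : -1ℤ * (β * γ) * (t * t) ≡[ n ] s * s
        -βγtt≡ss = congruent (go (∣-trans (∣ᵤ⇒∣ h∣n) n∣) g∣xx+βγ)
          where
          eq : ∀ g h β γ x y z →
               -1ℤ * (β * γ) * ((g * y + h) * (g * y + h)) - (g * γ * z + h * x) * (g * γ * z + h * x) ≡
               - (g * g * γ * (β * (y * y) + γ * (z * z)) + h * h * (x * x + β * γ) + + 2 * γ * (z * x + β * y) * (g * h))
          eq = solve-∀
          eq′ : ∀ g h γ q q′ w → - (g * g * γ * (q * h) + h * h * (q′ * g) + w * (g * h)) ≡ - (g * γ * q + h * q′ + w) * (g * h)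
          eq′ = solve-∀
          go : + h ∣ β * (y * y) + γ * (z * z) → + g ∣ x * x + β * γ → + n ∣ -1ℤ * (β * γ) * (t * t) - s * s
          go (divides q e₁) (divides q′ e₂) = divides (- (+ g * γ * q + + h * q′ + + 2 * γ * (z * x + β * y))) (begin
            -1ℤ * (β * γ) * (t * t) - s * s
              ≡⟨ eq (+ g) (+ h) β γ x y z ⟩
            - (+ g * + g * γ * (β * (y * y) + γ * (z * z)) + + h * + h * (x * x + β * γ) + w * (+ g * + h))
              ≡⟨ cong₂ (λ k l → - (+ g * + g * γ * k + + h * + h * l + w * (+ g * + h))) e₁ e₂ ⟩
            - (+ g * + g * γ * (q * + h) + + h * + h * (q′ * + g) + w * (+ g * + h))
              ≡⟨ eq′ (+ g) (+ h) γ q q′ w ⟩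
            - (+ g * γ * q + + h * q′ + w) * (+ g * + h)
              ≡⟨ cong (- (+ g * γ * q + + h * q′ + w) *_) (trans (sym (ℤ.pos-* g h)) (cong +_ (sym n≡gh))) ⟩
            - (+ g * γ * q + + h * q′ + w) * + n ∎)
            where
            open ≡-Reasoning
            w = + 2 * γ * (z * x + β * y)

        -βγ-unit : Unit n (-1ℤ * (β * γ))
        -βγ-unit = unit-* unit--1 (unit-* uβ uγ)

      jacobi-vanishes-at : jacobi (-1ℤ * (β * γ)) ≡ 0ℙ
      jacobi-vanishes-at = begin
        jacobi (-1ℤ * (β * γ))                          ≡⟨ ℙ.+-identityʳ _ ⟨
        jacobi (-1ℤ * (β * γ)) ℙ.+ 0ℙ                   ≡⟨ cong (jacobi (-1ℤ * (β * γ)) ℙ.+_) (jacobi-square t-unit) ⟨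
        jacobi (-1ℤ * (β * γ)) ℙ.+ jacobi (t * t)       ≡⟨ jacobi-* -βγ-unit (unit-* t-unit t-unit) ⟨
        jacobi (-1ℤ * (β * γ) * (t * t))                ≡⟨ jacobi-cong -βγtt-unit -βγtt≡ss ⟩
        jacobi (s * s)                                  ≡⟨ jacobi-square (unit-factorˡ s s (unit-cong -βγtt≡ss -βγtt-unit)) ⟩
        0ℙ                                              ∎
        where
        open ≡-Reasoning
        -βγtt-unit : Unit n (-1ℤ * (β * γ) * (t * t))
        -βγtt-unit = unit-* -βγ-unit (unit-* t-unit t-unit)

    jacobi-vanishes : OddUniversal (p * + n) β γ → jacobi (-1ℤ * (β * γ)) ≡ 0ℙ
    jacobi-vanishes U =
      let x , y , z , e = represent U (n ℕ.* n) (odd-* (odd-suc-2* N) (odd-suc-2* N)) (- (p * + n * β * γ))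
          g = gcd n ∣ y ∣
          g≢0 = ℕ.≢-nonZero (ℕ.gcd[m,n]≢0 n ∣ y ∣ (inj₁ λ ()))
      in jacobi-vanishes-at {x} {y} {z} {g} {ℕ._/_ n g {{g≢0}}} {{g≢0}}
           (sym (trans (ℕ.*-comm g _) (ℕ.m/n*n≡m {{g≢0}} (ℕ.gcd[m,n]∣m n ∣ y ∣)))) refl e

coefficient : ℕ → ℕ → ℤ
coefficient i A = + (2 ℕ.^ i) * + A

unit-2^ : ∀ {n} → Unit n (+ 2) → ∀ i → Unit n (+ (2 ℕ.^ i))
unit-2^ u2 zero    = unit 1ℤ ≡mod-refl
unit-2^ u2 (suc i) = subst (Unit _) (sym (ℤ.pos-* 2 (2 ℕ.^ i))) (unit-* u2 (unit-2^ u2 i))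

module _ (N : ℕ) where

  open Gauss N using (n; jacobi; jacobi-*; jacobi-cong; jacobi-square; jacobi-2; jacobi--1; unit-2)

  jacobi-1 : jacobi 1ℤ ≡ 0ℙ
  jacobi-1 = jacobi-square {1ℤ} (unit 1ℤ ≡mod-refl)

  jacobi-2^ : ∀ i → jacobi (+ (2 ℕ.^ i)) ≡ parity i ℙ.* triangular N
  jacobi-2^ zero    = jacobi-1
  jacobi-2^ (suc i) = begin
    jacobi (+ (2 ℕ.* 2 ℕ.^ i))                         ≡⟨ cong jacobi (ℤ.pos-* 2 (2 ℕ.^ i)) ⟩
    jacobi (+ 2 * + (2 ℕ.^ i))                         ≡⟨ jacobi-* unit-2 (unit-2^ unit-2 i) ⟩
    jacobi (+ 2) ℙ.+ jacobi (+ (2 ℕ.^ i))              ≡⟨ cong₂ ℙ._+_ jacobi-2 (jacobi-2^ i) ⟩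
    triangular N ℙ.+ (parity i ℙ.* triangular N)       ≡⟨ ℙ.*-distribʳ-+ (triangular N) 1ℙ (parity i) ⟨
    (1ℙ ℙ.+ parity i) ℙ.* triangular N                 ≡⟨ cong (ℙ._* triangular N) (parity-suc i) ⟨
    parity (suc i) ℙ.* triangular N                    ∎
    where open ≡-Reasoning

  coefficient-unit : ∀ i {A} → Coprime n A → Unit n (coefficient i A)
  coefficient-unit i c = unit-* (unit-2^ unit-2 i) (coprime-unit⁺ c)

  jacobi-coefficient : ∀ i {A} → Coprime n A →
    jacobi (coefficient i A) ≡ (parity i ℙ.* triangular N) ℙ.+ jacobi (+ A)
  jacobi-coefficient i {A} c =
    trans (jacobi-* (unit-2^ unit-2 i) (coprime-unit⁺ c)) (cong (ℙ._+ jacobi (+ A)) (jacobi-2^ i))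

  local-condition : ∀ {i j k B C} → SquareFree n → Coprime n B → Coprime n C →
    OddUniversal (coefficient i n) (coefficient j B) (coefficient k C) →
    parity N ℙ.+ ((parity j ℙ.+ parity k) ℙ.* triangular N) ℙ.+ (jacobi (+ B) ℙ.+ jacobi (+ C)) ≡ 0ℙ
  local-condition {i} {j} {k} {B} {C} sf n⊥B n⊥C U = begin
    parity N ℙ.+ ((parity j ℙ.+ parity k) ℙ.* t) ℙ.+ (jacobi (+ B) ℙ.+ jacobi (+ C))
      ≡⟨ eq (parity N) (parity j) (parity k) t (jacobi (+ B)) (jacobi (+ C)) ⟩
    parity N ℙ.+ ((parity j ℙ.* t) ℙ.+ jacobi (+ B) ℙ.+ ((parity k ℙ.* t) ℙ.+ jacobi (+ C)))
      ≡⟨ cong₂ ℙ._+_ jacobi--1 (cong₂ ℙ._+_ (jacobi-coefficient j n⊥B) (jacobi-coefficient k n⊥C)) ⟨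
    jacobi -1ℤ ℙ.+ (jacobi β ℙ.+ jacobi γ)
      ≡⟨ cong (jacobi -1ℤ ℙ.+_) (jacobi-* uβ uγ) ⟨
    jacobi -1ℤ ℙ.+ jacobi (β * γ)
      ≡⟨ jacobi-* unit--1 (unit-* uβ uγ) ⟨
    jacobi (-1ℤ * (β * γ))
      ≡⟨ jacobi-vanishes N (unit-2^ unit-2 i) uβ uγ sf U ⟩
    0ℙ ∎
    where
    open ≡-Reasoning
    t = triangular N
    β = coefficient j B
    γ = coefficient k C
    uβ = coefficient-unit j n⊥B
    uγ = coefficient-unit k n⊥C
    open ℙ-Solver
    eq : ∀ a j k t b c → a ℙ.+ ((j ℙ.+ k) ℙ.* t) ℙ.+ (b ℙ.+ c) ≡ a ℙ.+ ((j ℙ.* t) ℙ.+ b ℙ.+ ((k ℙ.* t) ℙ.+ c))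
    eq = solve 6 (λ a j k t b c → a :+ ((j :+ k) :* t) :+ (b :+ c) := a :+ ((j :* t) :+ b :+ ((k :* t) :+ c))) refl

record Anisotropic (i A j B k C : ℕ) : Set where
  constructor anisotropy
  field
    isotropy≡0 : OddUniversal (coefficient i A) (coefficient j B) (coefficient k C) →
                 isotropy (squareClass i A) (squareClass j B) (squareClass k C) ≡ 0ℙ

open Anisotropic

anisotropic-rotate : ∀ {i j k A B C} → Anisotropic j B k C i A → Anisotropic i A j B k C
anisotropic-rotate {i} {j} {k} {A} {B} {C} an = anisotropy λ U →
  trans (sym (isotropy-rotate (squareClass i A) (squareClass j B) (squareClass k C)))
        (isotropy≡0 an (rotate U))

module _ (L M N : ℕ) where

  private
    A = suc (2 ℕ.* L)
    B = suc (2 ℕ.* M)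
    C = suc (2 ℕ.* N)

  -- By reciprocity the three local conditions add up to isotropy.
  squareFree-coprime : ∀ {i j k} → SquareFree A → SquareFree B → SquareFree C →
    Coprime A B → Coprime B C → Coprime C A →
    OddUniversal (coefficient i A) (coefficient j B) (coefficient k C) →
    isotropy (class (parity i) (parity L) (triangular L))
             (class (parity j) (parity M) (triangular M))
             (class (parity k) (parity N) (triangular N)) ≡ 0ℙ
  squareFree-coprime {i} {j} {k} sfA sfB sfC A⊥B B⊥C C⊥A U = begin
    (a ℙ.+ b ℙ.+ c ℙ.+ (a ℙ.* b) ℙ.+ (b ℙ.* c) ℙ.+ (c ℙ.* a)) ℙ.+ (x ℙ.+ y ℙ.+ z)
      ≡⟨ cong₂ (λ e f → (a ℙ.+ b ℙ.+ c ℙ.+ (a ℙ.* b) ℙ.+ e ℙ.+ f) ℙ.+ (x ℙ.+ y ℙ.+ z))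
           (sym (reciprocity M N (unit′ (ℕ.sym B⊥C)) (unit′ B⊥C)))
           (sym (reciprocity N L (unit′ (ℕ.sym C⊥A)) (unit′ C⊥A))) ⟩
    (a ℙ.+ b ℙ.+ c ℙ.+ (a ℙ.* b) ℙ.+ (cb ℙ.+ bc) ℙ.+ (ac ℙ.+ ca)) ℙ.+ (x ℙ.+ y ℙ.+ z)
      ≡⟨ cong (λ e → (a ℙ.+ b ℙ.+ c ℙ.+ e ℙ.+ (cb ℙ.+ bc) ℙ.+ (ac ℙ.+ ca)) ℙ.+ (x ℙ.+ y ℙ.+ z))
           (sym (reciprocity L M (unit′ (ℕ.sym A⊥B)) (unit′ A⊥B))) ⟩
    (a ℙ.+ b ℙ.+ c ℙ.+ (ba ℙ.+ ab) ℙ.+ (cb ℙ.+ bc) ℙ.+ (ac ℙ.+ ca)) ℙ.+ (x ℙ.+ y ℙ.+ z)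
      ≡⟨ eq a b c x y z ab ba bc cb ca ac ⟩
    (a ℙ.+ x ℙ.+ (ab ℙ.+ ac)) ℙ.+ (b ℙ.+ y ℙ.+ (bc ℙ.+ ba)) ℙ.+ (c ℙ.+ z ℙ.+ (ca ℙ.+ cb))
      ≡⟨ cong₂ ℙ._+_ (cong₂ ℙ._+_ (local-condition L {i} {j} {k} sfA A⊥B (ℕ.sym C⊥A) U)
                                   (local-condition M {j} {k} {i} sfB B⊥C (ℕ.sym A⊥B) (rotate U)))
                      (local-condition N {k} {i} {j} sfC C⊥A (ℕ.sym B⊥C) (rotate (rotate U))) ⟩
    0ℙ ∎
    where
    open ≡-Reasoning
    a = parity L
    b = parity M
    c = parity N
    x = (parity j ℙ.+ parity k) ℙ.* triangular L
    y = (parity k ℙ.+ parity i) ℙ.* triangular M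
    z = (parity i ℙ.+ parity j) ℙ.* triangular N
    ab = Gauss.jacobi L (+ B)
    ac = Gauss.jacobi L (+ C)
    ba = Gauss.jacobi M (+ A)
    bc = Gauss.jacobi M (+ C)
    ca = Gauss.jacobi N (+ A)
    cb = Gauss.jacobi N (+ B)
    unit′ : ∀ {m n} → Coprime m n → Unit m (+ n)
    unit′ = coprime-unit⁺
    open ℙ-Solver
    eq : ∀ a b c x y z ab ba bc cb ca ac →
      (a ℙ.+ b ℙ.+ c ℙ.+ (ba ℙ.+ ab) ℙ.+ (cb ℙ.+ bc) ℙ.+ (ac ℙ.+ ca)) ℙ.+ (x ℙ.+ y ℙ.+ z) ≡
      (a ℙ.+ x ℙ.+ (ab ℙ.+ ac)) ℙ.+ (b ℙ.+ y ℙ.+ (bc ℙ.+ ba)) ℙ.+ (c ℙ.+ z ℙ.+ (ca ℙ.+ cb))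
    eq = solve 12 (λ a b c x y z ab ba bc cb ca ac →
      (a :+ b :+ c :+ (ba :+ ab) :+ (cb :+ bc) :+ (ac :+ ca)) :+ (x :+ y :+ z) :=
      (a :+ x :+ (ab :+ ac)) :+ (b :+ y :+ (bc :+ ba)) :+ (c :+ z :+ (ca :+ cb))) refl

squareClass-* : ∀ i {A B} → Odd A → Odd B → squareClass i (A ℕ.* B) ≡ scale (class 0ℙ (χ₄ A) (χ₈ A)) (squareClass i B)
squareClass-* i {A} {B} oA oB = cong₂ (class (parity i)) (χ₄-* oA oB) (χ₈-* oA oB)

anisotropic-square : ∀ d {i A j B k C} → Odd (d ℕ.* d ℕ.* A) →
  Anisotropic i A j B k C → Anisotropic i (d ℕ.* d ℕ.* A) j B k C
anisotropic-square d {i} {A} {j} {B} {k} {C} oddA an = anisotropy λ U → trans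
  (cong (λ c → isotropy c (squareClass j B) (squareClass k C)) class≡)
  (isotropy≡0 an (remove-square (+ d) (subst (λ α → OddUniversal α (coefficient j B) (coefficient k C)) coefficient≡ U)))
  where
  odd-A : Odd A
  odd-A = proj₂ (odd-factors (d ℕ.* d) A oddA)
  odd-dd : Odd (d ℕ.* d)
  odd-dd = proj₁ (odd-factors (d ℕ.* d) A oddA)
  odd-d : Odd d
  odd-d = proj₁ (odd-factors d d odd-dd)
  coefficient≡ : coefficient i (d ℕ.* d ℕ.* A) ≡ + d * + d * coefficient i A
  coefficient≡ = trans (cong (+ (2 ℕ.^ i) *_) (trans (ℤ.pos-* (d ℕ.* d) A) (cong (_* + A) (ℤ.pos-* d d))))
    (eq (+ (2 ℕ.^ i)) (+ d) (+ A))
    where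
    eq : ∀ p d A → p * (d * d * A) ≡ d * d * (p * A)
    eq = solve-∀
  cancel : ∀ {p} q r → p ≡ q ℙ.+ q → p ℙ.+ r ≡ r
  cancel q r refl = cong (ℙ._+ r) (ℙ.p+p≡0ℙ q)
  class≡ : squareClass i (d ℕ.* d ℕ.* A) ≡ squareClass i A
  class≡ = cong₂ (class (parity i))
    (trans (χ₄-* odd-dd odd-A) (cancel (χ₄ d) (χ₄ A) (χ₄-* odd-d odd-d)))
    (trans (χ₈-* odd-dd odd-A) (cancel (χ₈ d) (χ₈ A) (χ₈-* odd-d odd-d)))

remove-common : ∀ {g} .{{_ : NonZero g}} {α β γ} → Odd g → SquareFree g → Unit g γ →
  OddUniversal (+ g * α) (+ g * β) γ → OddUniversal α β (+ g * γ)
remove-common {g} {α} {β} {γ} og sf uγ U = oddUniversal λ m om r →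
  let x , y , z , congruent e = represent U (g ℕ.* m) (odd-* og om) (+ g * r)
      g∣z = g∣z x y z (∣-trans (∣ᵤ⇒∣ (ℕ.m∣m*n m)) e)
  in x , y , quotient g∣z , congruent (*-cancelˡ-∣ (+ g) (subst₂ _∣_ (ℤ.pos-* g m) (cancelled x y g∣z) e))
  where
  g∣z : ∀ x y z {r} → + g ∣ value (+ g * α) (+ g * β) γ x y z - + g * r → + g ∣ z
  g∣z x y z {r} e = ∣ᵤ⇒∣ (squareFree-root ∣ z ∣ sf (subst (g ℕ.∣_) (ℤ.abs-* z z)
    (∣⇒∣ᵤ (unit-cancel (z * z) uγ (∣-lin₂ 1ℤ (r - α * (x * x) - β * (y * y)) (eq (+ g) α β γ x y z r) e ∣-refl)))))
    where
    eq : ∀ g α β γ x y z r → γ * (z * z) ≡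
         1ℤ * (g * α * (x * x) + g * β * (y * y) + γ * (z * z) - g * r) + (r - α * (x * x) - β * (y * y)) * g
    eq = solve-∀
  cancelled : ∀ x y {z r} (g∣z : + g ∣ z) → value (+ g * α) (+ g * β) γ x y z - + g * r ≡
              + g * (value α β (+ g * γ) x y (quotient g∣z) - r)
  cancelled x y {r = r} (divides w refl) = eq (+ g) α β γ x y w r
    where
    eq : ∀ g α β γ x y w r → g * α * (x * x) + g * β * (y * y) + γ * (w * g * (w * g)) - g * r ≡
         g * (α * (x * x) + β * (y * y) + g * γ * (w * w) - r)
    eq = solve-∀

common-coprime : ∀ {g α β} k {C} → Odd g → OddUniversal (+ g * α) (+ g * β) (coefficient k C) → Coprime g C
common-coprime {g} {α} {β} k {C} og U {d} (d∣g@(ℕ.divides q g≡) , d∣C) =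
  ℕ.∣1⇒≡1 (∣⇒∣ᵤ (d∣1 (represent U d (proj₂ (odd-factors q d (subst Odd g≡ og))) 1ℤ)))
  where
  d∣1 : ∃[ x ] ∃[ y ] ∃[ z ] value (+ g * α) (+ g * β) (coefficient k C) x y z ≡[ d ] 1ℤ → + d ∣ 1ℤ
  d∣1 (x , y , z , congruent e) = ∣-lin₂ -1ℤ 1ℤ (eq (+ g) α β (+ (2 ℕ.^ k)) (+ C) x y z) e
    (∣m∣n⇒∣m+n (∣m⇒∣m*n {m = + g} (α * (x * x) + β * (y * y)) (∣ᵤ⇒∣ d∣g))
      (∣m⇒∣m*n {m = + C} (+ (2 ℕ.^ k) * (z * z)) (∣ᵤ⇒∣ d∣C)))
    where
    eq : ∀ g α β p C x y z → 1ℤ ≡ -1ℤ * (g * α * (x * x) + g * β * (y * y) + p * C * (z * z) - 1ℤ) +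
           1ℤ * (g * (α * (x * x) + β * (y * y)) + C * (p * (z * z)))
    eq = solve-∀

anisotropic-common : ∀ {g i A j B k C} → Odd (g ℕ.* A) → Odd (g ℕ.* B) → Odd C → SquareFree g →
  Anisotropic i A j B k (g ℕ.* C) → Anisotropic i (g ℕ.* A) j (g ℕ.* B) k C
anisotropic-common {g} {i} {A} {j} {B} {k} {C} ogA ogB oC sf an = anisotropy main
  where
  open ≡-Reasoning
  og = proj₁ (odd-factors g A ogA)
  oA = proj₂ (odd-factors g A ogA)
  oB = proj₂ (odd-factors g B ogB)
  cg = class 0ℙ (χ₄ g) (χ₈ g)
  pull : ∀ i A → coefficient i (g ℕ.* A) ≡ + g * coefficient i A
  pull i A = trans (cong (+ (2 ℕ.^ i) *_) (ℤ.pos-* g A)) (eq (+ (2 ℕ.^ i)) (+ g) (+ A))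
    where
    eq : ∀ p g A → p * (g * A) ≡ g * (p * A)
    eq = solve-∀
  main : OddUniversal (coefficient i (g ℕ.* A)) (coefficient j (g ℕ.* B)) (coefficient k C) →
         isotropy (squareClass i (g ℕ.* A)) (squareClass j (g ℕ.* B)) (squareClass k C) ≡ 0ℙ
  main U = begin
    isotropy (squareClass i (g ℕ.* A)) (squareClass j (g ℕ.* B)) (squareClass k C)
      ≡⟨ cong₂ (λ a b → isotropy a b (squareClass k C)) (squareClass-* i og oA) (squareClass-* j og oB) ⟩
    isotropy (scale cg (squareClass i A)) (scale cg (squareClass j B)) (squareClass k C)
      ≡⟨ isotropy-scale (χ₄ g) (χ₈ g) (squareClass i A) (squareClass j B) (squareClass k C) ⟩
    isotropy (squareClass i A) (squareClass j B) (scale cg (squareClass k C))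
      ≡⟨ cong (isotropy (squareClass i A) (squareClass j B)) (squareClass-* k og oC) ⟨
    isotropy (squareClass i A) (squareClass j B) (squareClass k (g ℕ.* C))
      ≡⟨ isotropy≡0 an (subst (OddUniversal (coefficient i A) (coefficient j B)) (sym (pull k C))
           (remove-common {g} {{odd-nonZero og}} og sf g-unit U′)) ⟩
    0ℙ ∎
    where
    U′ : OddUniversal (+ g * coefficient i A) (+ g * coefficient j B) (coefficient k C)
    U′ = subst₂ (λ α β → OddUniversal α β (coefficient k C)) (pull i A) (pull j B) U
    g-unit : Unit g (coefficient k C)
    g-unit = subst (λ n → Unit n (coefficient k C)) (sym (odd-form og))
      (coefficient-unit ⌊ g /2⌋ k (subst (λ n → Coprime n C) (odd-form og) (common-coprime k og U′)))

squareFree? : ∀ A .{{_ : NonZero A}} → SquareFree A ⊎ ∃[ d ] ∃[ A′ ] (1 ℕ.< d × A ≡ d ℕ.* d ℕ.* A′)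
squareFree? A with ℕ.anyUpTo? (λ d → (2 ℕ.≤? d) ×-dec (d ℕ.* d ℕ.∣? A)) (suc A)
... | yes (d , _ , 1<d , ℕ.divides q eq) = inj₂ (d , q , 1<d , trans eq (ℕ.*-comm q (d ℕ.* d)))
... | no none = inj₁ sf
  where
  sf : SquareFree A
  sf zero          dd∣A = contradiction (ℕ.0∣⇒≡0 dd∣A) (ℕ.≢-nonZero⁻¹ A)
  sf (suc zero)    _    = refl
  sf d@(suc (suc _)) dd∣A = contradiction
    (d , ℕ.s≤s (ℕ.≤-trans (ℕ.m≤m*n d d) (ℕ.∣⇒≤ dd∣A)) , ℕ.s≤s (ℕ.s≤s ℕ.z≤n) , dd∣A) none

coprime-or-common : ∀ A B .{{_ : NonZero A}} → Coprime A B ⊎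
  ∃[ g ] ∃[ A′ ] ∃[ B′ ] (1 ℕ.< g × A ≡ g ℕ.* A′ × B ≡ g ℕ.* B′)
coprime-or-common A B with gcd A B in g≡ | ℕ.gcd[m,n]∣m A B | ℕ.gcd[m,n]∣n A B
... | zero        | g∣A | _ = contradiction (ℕ.0∣⇒≡0 g∣A) (ℕ.≢-nonZero⁻¹ A)
... | suc zero    | _   | _ = inj₁ (ℕ.gcd≡1⇒coprime g≡)
... | g@(suc (suc _)) | ℕ.divides A′ eA | ℕ.divides B′ eB =
  inj₂ (g , A′ , B′ , ℕ.s≤s (ℕ.s≤s ℕ.z≤n) , trans eA (ℕ.*-comm A′ g) , trans eB (ℕ.*-comm B′ g))

private
  <-scaled : ∀ {m n d} → Odd n → 1 ℕ.< d → n ≡ m ℕ.* d → m ℕ.< n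
  <-scaled {m} {n} {d} on 1<d refl = ℕ.m<m*n m d {{odd-nonZero (proj₁ (odd-factors m d on))}} 1<d

  odd-*₃ : ∀ {A B C} → Odd A → Odd B → Odd C → Odd (A ℕ.* B ℕ.* C)
  odd-*₃ oA oB oC = odd-* (odd-* oA oB) oC

  1<d*d : ∀ {d} → 1 ℕ.< d → 1 ℕ.< d ℕ.* d
  1<d*d {d} 1<d = ℕ.<-≤-trans 1<d (ℕ.m≤m*n d d {{ℕ.>-nonZero (ℕ.<-trans (ℕ.s≤s ℕ.z≤n) 1<d)}})

AnisotropicBelow : ℕ → Set
AnisotropicBelow n = ∀ {i A j B k C} → Odd A → Odd B → Odd C → A ℕ.* B ℕ.* C ℕ.< n → Anisotropic i A j B k C

anisotropic-square? : ∀ {i A j B k C} → Odd A → Odd B → Odd C → AnisotropicBelow (A ℕ.* B ℕ.* C) →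
  SquareFree A ⊎ Anisotropic i A j B k C
anisotropic-square? {A = A} {B = B} {C = C} oA oB oC rec with squareFree? A {{odd-nonZero oA}}
... | inj₁ sf = inj₁ sf
... | inj₂ (d , A′ , 1<d , refl) = inj₂ (anisotropic-square d oA
        (rec (proj₂ (odd-factors (d ℕ.* d) A′ oA)) oB oC
          (<-scaled (odd-*₃ oA oB oC) (1<d*d 1<d) (eq d A′ B C))))
  where
  eq : ∀ d A B C → d ℕ.* d ℕ.* A ℕ.* B ℕ.* C ≡ A ℕ.* B ℕ.* C ℕ.* (d ℕ.* d)
  eq = ℕ-Ring.solve-∀

anisotropic-common? : ∀ {i A j B k C} → Odd A → Odd B → Odd C → SquareFree A → AnisotropicBelow (A ℕ.* B ℕ.* C) →
  Coprime A B ⊎ Anisotropic i A j B k C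
anisotropic-common? {A = A} {B = B} {C = C} oA oB oC sfA rec with coprime-or-common A B {{odd-nonZero oA}}
... | inj₁ c = inj₁ c
... | inj₂ (g , A′ , B′ , 1<g , refl , refl) =
  let og , oA′ = odd-factors g A′ oA
      _  , oB′ = odd-factors g B′ oB
  in inj₂ (anisotropic-common {g} {A = A′} {B = B′} oA oB oC (squareFree-∣ (ℕ.m∣m*n A′) sfA)
       (rec oA′ oB′ (odd-* og oC) (<-scaled (odd-*₃ oA oB oC) 1<g (eq g A′ B′ C))))
  where
  eq : ∀ g A B C → g ℕ.* A ℕ.* (g ℕ.* B) ℕ.* C ≡ A ℕ.* B ℕ.* (g ℕ.* C) ℕ.* g
  eq = ℕ-Ring.solve-∀

anisotropic-step : ∀ {i A j B k C} → Odd A → Odd B → Odd C →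
  AnisotropicBelow (A ℕ.* B ℕ.* C) → Anisotropic i A j B k C
anisotropic-step {i} {A} {j} {B} {k} {C} oA oB oC rec = step
  (anisotropic-square? oA oB oC rec) (anisotropic-square? oB oC oA rec₁) (anisotropic-square? oC oA oB rec₂)
  where
  rec₁ : AnisotropicBelow (B ℕ.* C ℕ.* A)
  rec₁ = subst AnisotropicBelow (eq A B C) rec
    where
    eq : ∀ A B C → A ℕ.* B ℕ.* C ≡ B ℕ.* C ℕ.* A
    eq = ℕ-Ring.solve-∀
  rec₂ : AnisotropicBelow (C ℕ.* A ℕ.* B)
  rec₂ = subst AnisotropicBelow (eq A B C) rec
    where
    eq : ∀ A B C → A ℕ.* B ℕ.* C ≡ C ℕ.* A ℕ.* B
    eq = ℕ-Ring.solve-∀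
  rotate₁ : Anisotropic j B k C i A → Anisotropic i A j B k C
  rotate₁ = anisotropic-rotate
  rotate₂ : Anisotropic k C i A j B → Anisotropic i A j B k C
  rotate₂ an = anisotropic-rotate (anisotropic-rotate an)
  step : SquareFree A ⊎ Anisotropic i A j B k C → SquareFree B ⊎ Anisotropic j B k C i A →
         SquareFree C ⊎ Anisotropic k C i A j B → Anisotropic i A j B k C
  step (inj₂ an)  _          _          = an
  step (inj₁ _)   (inj₂ an)  _          = rotate₁ an
  step (inj₁ _)   (inj₁ _)   (inj₂ an)  = rotate₂ an
  step (inj₁ sfA) (inj₁ sfB) (inj₁ sfC) = step′
    (anisotropic-common? oA oB oC sfA rec) (anisotropic-common? oB oC oA sfB rec₁) (anisotropic-common? oC oA oB sfC rec₂)
    where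
    step′ : Coprime A B ⊎ Anisotropic i A j B k C → Coprime B C ⊎ Anisotropic j B k C i A →
            Coprime C A ⊎ Anisotropic k C i A j B → Anisotropic i A j B k C
    step′ (inj₂ an)  _          _          = an
    step′ (inj₁ _)   (inj₂ an)  _          = rotate₁ an
    step′ (inj₁ _)   (inj₁ _)   (inj₂ an)  = rotate₂ an
    step′ (inj₁ A⊥B) (inj₁ B⊥C) (inj₁ C⊥A) = base (odd-form oA) (odd-form oB) (odd-form oC)
      where
      L = ⌊ A /2⌋
      M = ⌊ B /2⌋
      N = ⌊ C /2⌋
      base : A ≡ suc (2 ℕ.* L) → B ≡ suc (2 ℕ.* M) → C ≡ suc (2 ℕ.* N) → Anisotropic i A j B k C
      base eA eB eC = anisotropy λ U → squareFree-coprime L M N {i} {j} {k}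
        (subst SquareFree eA sfA) (subst SquareFree eB sfB) (subst SquareFree eC sfC)
        (subst₂ Coprime eA eB A⊥B) (subst₂ Coprime eB eC B⊥C) (subst₂ Coprime eC eA C⊥A)
        (subst (OddUniversal _ _) (cong (coefficient k) eC)
          (subst₂ (λ α β → OddUniversal α β _) (cong (coefficient i) eA) (cong (coefficient j) eB) U))

anisotropic : ∀ {i A j B k C} → Odd A → Odd B → Odd C → Anisotropic i A j B k C
anisotropic oA oB oC = go (<-wellFounded _) oA oB oC refl
  where
  go : ∀ {n} → Acc ℕ._<_ n → ∀ {i A j B k C} → Odd A → Odd B → Odd C → A ℕ.* B ℕ.* C ≡ n → Anisotropic i A j B k C
  go (acc rec) oA oB oC refl = anisotropic-step oA oB oC λ oA′ oB′ oC′ lt → go (rec lt) oA′ oB′ oC′ refl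

-- Density

module _ {P : ℕ → Set} (P? : Decidable P) where

  count-suc : ∀ N → count P? (suc N) ≡ count P? N ℕ.+ length (filter P? (suc N ∷ []))
  count-suc N = begin
    length (filter P? (applyUpTo suc (suc N)))        ≡⟨ cong (λ xs → length (filter P? xs)) (List.applyUpTo-∷ʳ suc N) ⟨
    length (filter P? (applyUpTo suc N ∷ʳ suc N))     ≡⟨ cong length (List.filter-++ P? (applyUpTo suc N) _) ⟩
    length (filter P? (applyUpTo suc N) List.++ filter P? (suc N ∷ [])) ≡⟨ List.length-++ (filter P? (applyUpTo suc N)) ⟩
    count P? N ℕ.+ length (filter P? (suc N ∷ []))    ∎
    where open ≡-Reasoning

  count-suc-≤ : ∀ N → count P? (suc N) ℕ.≤ suc (count P? N)
  count-suc-≤ N = subst (ℕ._≤ suc (count P? N)) (sym (count-suc N))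
    (ℕ.≤-trans (ℕ.+-monoʳ-≤ (count P? N) (List.length-filter P? (suc N ∷ []))) (ℕ.≤-reflexive (ℕ.+-comm _ 1)))

  count-suc-∉ : ∀ N → ¬ P (suc N) → count P? (suc N) ≡ count P? N
  count-suc-∉ N ¬p = trans (count-suc N)
    (trans (cong (λ xs → count P? N ℕ.+ length xs) (List.filter-reject P? ¬p)) (ℕ.+-identityʳ _))

  count-+ : ∀ k N → count P? (k ℕ.+ N) ℕ.≤ k ℕ.+ count P? N
  count-+ zero    N = ℕ.≤-refl
  count-+ (suc k) N = ℕ.≤-trans (count-suc-≤ (k ℕ.+ N)) (ℕ.s≤s (count-+ k N))

  count-block : ∀ {m j} → j ℕ.< m → ∀ N → ¬ P (suc (j ℕ.+ N)) → suc (count P? (m ℕ.+ N)) ℕ.≤ m ℕ.+ count P? N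
  count-block {m} {j} j<m N ¬p = begin
    suc (count P? (m ℕ.+ N))              ≡⟨ cong (λ e → suc (count P? (e ℕ.+ N))) m≡ ⟨
    suc (count P? (k ℕ.+ suc j ℕ.+ N))    ≡⟨ cong (λ e → suc (count P? e)) (ℕ.+-assoc k (suc j) N) ⟩
    suc (count P? (k ℕ.+ suc (j ℕ.+ N)))  ≤⟨ ℕ.s≤s (count-+ k (suc (j ℕ.+ N))) ⟩
    suc (k ℕ.+ count P? (suc (j ℕ.+ N)))  ≡⟨ cong (λ e → suc (k ℕ.+ e)) (count-suc-∉ (j ℕ.+ N) ¬p) ⟩
    suc (k ℕ.+ count P? (j ℕ.+ N))        ≤⟨ ℕ.s≤s (ℕ.+-monoʳ-≤ k (count-+ j N)) ⟩
    suc (k ℕ.+ (j ℕ.+ count P? N))        ≡⟨ eq k j (count P? N) ⟩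
    k ℕ.+ suc j ℕ.+ count P? N            ≡⟨ cong (ℕ._+ count P? N) m≡ ⟩
    m ℕ.+ count P? N                      ∎
    where
    open ℕ.≤-Reasoning
    k = m ℕ.∸ suc j
    m≡ : k ℕ.+ suc j ≡ m
    m≡ = ℕ.m∸n+n≡m j<m
    eq : ∀ k j c → suc (k ℕ.+ (j ℕ.+ c)) ≡ k ℕ.+ suc j ℕ.+ c
    eq = ℕ-Ring.solve-∀

  count-blocks : ∀ {m j} → j ℕ.< m → ∀ t → (∀ s → s ℕ.< t → ¬ P (suc (j ℕ.+ s ℕ.* m))) →
                 count P? (t ℕ.* m) ℕ.+ t ℕ.≤ t ℕ.* m
  count-blocks j<m zero    ¬p = ℕ.z≤n
  count-blocks {m} {j} j<m (suc t) ¬p = begin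
    count P? (m ℕ.+ t ℕ.* m) ℕ.+ suc t     ≡⟨ ℕ.+-suc _ t ⟩
    suc (count P? (m ℕ.+ t ℕ.* m)) ℕ.+ t   ≤⟨ ℕ.+-monoˡ-≤ t (count-block j<m (t ℕ.* m) (¬p t ℕ.≤-refl)) ⟩
    m ℕ.+ count P? (t ℕ.* m) ℕ.+ t         ≡⟨ ℕ.+-assoc m _ t ⟩
    m ℕ.+ (count P? (t ℕ.* m) ℕ.+ t)       ≤⟨ ℕ.+-monoʳ-≤ m (count-blocks j<m t λ s s<t → ¬p s (ℕ.m<n⇒m<1+n s<t)) ⟩
    m ℕ.+ t ℕ.* m                          ∎
    where open ℕ.≤-Reasoning

∣p-1∣<ε⇒1<p+ε : ∀ p ε → ℚ.∣ p ℚ.- 1ℚ ∣ ℚ.< ε → 1ℚ ℚ.< p ℚ.+ ε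
∣p-1∣<ε⇒1<p+ε p ε lt = subst (ℚ._< p ℚ.+ ε) p-[p-1]≡1 (ℚ.+-monoʳ-< p (-q<ε (ℚ.∣p∣≡p∨∣p∣≡-p q)))
  where
  q = p ℚ.- 1ℚ
  -q<ε : ℚ.∣ q ∣ ≡ q ⊎ ℚ.∣ q ∣ ≡ ℚ.- q → ℚ.- q ℚ.< ε
  -q<ε (inj₂ ∣q∣≡-q) = subst (ℚ._< ε) ∣q∣≡-q lt
  -q<ε (inj₁ ∣q∣≡q)  = ℚ.≤-<-trans (ℚ.neg-antimono-≤ (ℚ.∣p∣≡p⇒0≤p ∣q∣≡q)) (ℚ.≤-<-trans (ℚ.0≤∣p∣ q) lt)
  p-[p-1]≡1 : p ℚ.- (p ℚ.- 1ℚ) ≡ 1ℚ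
  p-[p-1]≡1 = begin
    p ℚ.- (p ℚ.- 1ℚ)         ≡⟨ cong (p ℚ.+_) (ℚ.neg-distrib-+ p (ℚ.- 1ℚ)) ⟩
    p ℚ.+ (ℚ.- p ℚ.+ 1ℚ)     ≡⟨ ℚ.+-assoc p (ℚ.- p) 1ℚ ⟨
    p ℚ.- p ℚ.+ 1ℚ           ≡⟨ cong (ℚ._+ 1ℚ) (ℚ.+-inverseʳ p) ⟩
    0ℚ ℚ.+ 1ℚ                ≡⟨ ℚ.+-identityˡ 1ℚ ⟩
    1ℚ                       ∎
    where open ≡-Reasoning

1<c/N+1/m : ∀ c N m .{{_ : NonZero N}} .{{_ : NonZero m}} →
  1ℚ ℚ.< + c ℚ./ N ℚ.+ 1ℤ ℚ./ m → N ℕ.* m ℕ.< c ℕ.* m ℕ.+ N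
1<c/N+1/m c (suc N) (suc m) lt = ℤ.drop‿+<+ (subst₂ ℤ._<_ lhs rhs (ℚᵘ.drop-*<* unnormalised))
  where
  unnormalised : toℚᵘ 1ℚ ℚᵘ.< mkℚᵘ (+ c) N ℚᵘ.+ mkℚᵘ 1ℤ m
  unnormalised = ℚᵘ.<-respʳ-≃
    (ℚᵘ.≃-trans (ℚ.toℚᵘ-homo-+ (+ c ℚ./ suc N) (1ℤ ℚ./ suc m))
      (ℚᵘ.+-cong (ℚ.toℚᵘ-fromℚᵘ (mkℚᵘ (+ c) N)) (ℚ.toℚᵘ-fromℚᵘ (mkℚᵘ 1ℤ m))))
    (ℚ.toℚᵘ-mono-< lt)
  lhs : 1ℤ * + (suc N ℕ.* suc m) ≡ + (suc N ℕ.* suc m)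
  lhs = ℤ.*-identityˡ _
  rhs : (+ c * + suc m + 1ℤ * + suc N) * 1ℤ ≡ + (c ℕ.* suc m ℕ.+ suc N)
  rhs = trans (ℤ.*-identityʳ _) (cong₂ _+_ (sym (ℤ.pos-* c (suc m))) (ℤ.*-identityˡ (+ suc N)))

-- A missed residue class modulo m costs density 1 / m.
hits-residue : ∀ F a b c {{_ : NonZero a}} {{_ : NonZero b}} {{_ : NonZero c}} →
  AsymptoticallyUniversal F a b c → ∀ {m j} → j ℕ.< m → ∃[ t ] Represents F a b c (suc (j ℕ.+ t ℕ.* m))
hits-residue F a b c AU {m@(suc _)} {j} j<m with AU (1ℤ ℚ./ m) (ℚ.positive⁻¹ (1ℤ ℚ./ m) {{ℚ.normalize-pos 1 m}})
... | N₀ , close with ℕ.anyUpTo? (λ t → represents? F a b c (suc (j ℕ.+ t ℕ.* m))) (suc N₀)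
...   | yes (t , _ , r) = t , r
...   | no none = contradiction (count-blocks P? j<m (suc N₀) λ s s<t p → none (s , s<t , p)) (ℕ.<⇒≱ N<count+t)
  where
  P? = represents? F a b c
  N = suc N₀ ℕ.* m
  C = count P? N
  instance
    N≢0 : NonZero N
    N≢0 = ℕ.m*n≢0 (suc N₀) m
  N₀≤N : N₀ ℕ.≤ N
  N₀≤N = ℕ.≤-trans (ℕ.n≤1+n N₀) (ℕ.m≤m*n (suc N₀) m)
  N<count+t : N ℕ.< C ℕ.+ suc N₀
  N<count+t = ℕ.*-cancelʳ-< m N (C ℕ.+ suc N₀) (subst (N ℕ.* m ℕ.<_) (sym (ℕ.*-distribʳ-+ m C (suc N₀)))
    (1<c/N+1/m C N m (∣p-1∣<ε⇒1<p+ε (+ C ℚ./ N) (1ℤ ℚ./ m) (close N N₀≤N))))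

-- The five forms

odd-unit-2^ : ∀ {m} → Odd m → ∀ i → Unit m (+ (2 ℕ.^ i))
odd-unit-2^ {m} om = subst (λ m → ∀ i → Unit m (+ (2 ℕ.^ i))) (sym (odd-form om)) (unit-2^ (Gauss.unit-2 ⌊ m /2⌋))

module _ {F : Form} {a b c : ℕ} {{_ : NonZero a}} {{_ : NonZero b}} {{_ : NonZero c}}
         (α β γ : ℤ) (s : ℤ)
         (complete : ∀ x y z → ∃[ X ] ∃[ Y ] ∃[ Z ] + 8 * eval F a b c x y z + s ≡ value α β γ X Y Z) where

  oddUniversal⁺ : AsymptoticallyUniversal F a b c → OddUniversal α β γ
  oddUniversal⁺ AU = oddUniversal represents
    where
    represents : ∀ m → Odd m → ∀ r → ∃[ X ] ∃[ Y ] ∃[ Z ] value α β γ X Y Z ≡[ m ] r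
    represents m om r =
      let t , x , y , z , n≡ = hits-residue F a b c AU (n%ℕd<d n₁ m)
          X , Y , Z , e      = complete x y z
      in X , Y , Z , ≡mod-trans (≡mod-reflexive (trans (sym e) (cong (λ n → + 8 * n + s) (sym n≡)))) (main t)
      where
      instance
        m≢0 : NonZero m
        m≢0 = odd-nonZero om
      8-unit : Unit m (+ 8)
      8-unit = odd-unit-2^ om 3
      w = Unit.inverse 8-unit
      n₁ = w * (r - s) - 1ℤ
      j = n₁ %ℕ m
      main : ∀ t → + 8 * + suc (j ℕ.+ t ℕ.* m) + s ≡[ m ] r
      main t = ≡mod-trans
        (≡mod-reflexive (cong (λ n → + 8 * n + s) (cong (λ e → 1ℤ + (+ j + e)) (ℤ.pos-* t m))))
        (≡mod-trans (≡mod-lin₂ (+ 8) (+ 8 * + t) (eq₁ (+ j) (+ t) (+ m) n₁ s) (≡mod-sym (%ℕ-mod n₁ m)) (∣⇒≡0 {x = + m} ∣-refl))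
          (≡mod-lin₁ (r - s) (eq₂ w r s) (Unit.*-inverse 8-unit)))
        where
        eq₁ : ∀ j t m n₁ s → + 8 * (1ℤ + (j + t * m)) + s - (+ 8 * (1ℤ + n₁) + s) ≡ + 8 * (j - n₁) + + 8 * t * (m - + 0)
        eq₁ = solve-∀
        eq₂ : ∀ w r s → + 8 * (1ℤ + (w * (r - s) - 1ℤ)) + s - r ≡ (r - s) * (+ 8 * w - 1ℤ)
        eq₂ = solve-∀

largestPower-∣ : ∀ k n → 2 ℕ.^ largestPower k n ℕ.∣ n
largestPower-∣ zero    n = ℕ.1∣ n
largestPower-∣ (suc k) n with 2 ℕ.^ suc k ℕ.∣? n
... | yes 2^∣n = 2^∣n
... | no  _    = largestPower-∣ k n

largestPower-largest : ∀ k n {j} → j ℕ.≤ k → 2 ℕ.^ j ℕ.∣ n → j ℕ.≤ largestPower k n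
largestPower-largest zero    n j≤k 2^∣n = j≤k
largestPower-largest (suc k) n j≤k 2^∣n with 2 ℕ.^ suc k ℕ.∣? n
... | yes _ = j≤k
... | no ∤n with ℕ.m≤n⇒m<n∨m≡n j≤k
...   | inj₁ j<sk = largestPower-largest k n (ℕ.≤-pred j<sk) 2^∣n
...   | inj₂ refl = contradiction 2^∣n ∤n

n<2^n : ∀ n → n ℕ.< 2 ℕ.^ n
n<2^n zero    = ℕ.s≤s ℕ.z≤n
n<2^n (suc n) = ℕ.≤-trans (ℕ.s≤s (n<2^n n)) (ℕ.+-mono-≤ (ℕ.m^n>0 2 n) (ℕ.≤-reflexive (sym (ℕ.+-identityʳ _))))

2^v₂*oddPart : ∀ n → 2 ℕ.^ v₂ n ℕ.* oddPart n ≡ n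
2^v₂*oddPart n = ℕ.m*[n/m]≡n {{ℕ.m^n≢0 2 (v₂ n)}} (largestPower-∣ n n)

parity≡0⇒2∣ : ∀ n → parity n ≡ 0ℙ → 2 ℕ.∣ n
parity≡0⇒2∣ zero          _ = 2 ℕ.∣0
parity≡0⇒2∣ (suc (suc n)) e = ℕ.∣m∣n⇒∣m+n ℕ.∣-refl (parity≡0⇒2∣ n e)

oddPart-odd : ∀ n {{_ : NonZero n}} → Odd (oddPart n)
oddPart-odd n with parity (oddPart n) in e
... | 1ℙ = odd e
... | 0ℙ = contradiction (largestPower-largest n n v<n 2^sv∣n) (ℕ.<⇒≱ ℕ.≤-refl)
  where
  2^sv∣n : 2 ℕ.^ suc (v₂ n) ℕ.∣ n
  2^sv∣n = subst₂ ℕ._∣_ (ℕ.*-comm (2 ℕ.^ v₂ n) 2) (2^v₂*oddPart n) (ℕ.*-monoʳ-∣ (2 ℕ.^ v₂ n) (parity≡0⇒2∣ (oddPart n) e))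
  v<n : v₂ n ℕ.< n
  v<n = ℕ.<⇒≤ (ℕ.<-≤-trans (n<2^n (suc (v₂ n))) (ℕ.∣⇒≤ 2^sv∣n))

coefficient-v₂ : ∀ n → coefficient (v₂ n) (oddPart n) ≡ + n
coefficient-v₂ n = trans (sym (ℤ.pos-* (2 ℕ.^ v₂ n) (oddPart n))) (cong +_ (2^v₂*oddPart n))

coefficient-3+v₂ : ∀ n → coefficient (3 ℕ.+ v₂ n) (oddPart n) ≡ + 8 * + n
coefficient-3+v₂ n = begin
  + (2 ℕ.^ (3 ℕ.+ v₂ n)) * + oddPart n     ≡⟨ cong (λ e → + e * + oddPart n) (ℕ.^-distribˡ-+-* 2 3 (v₂ n)) ⟩
  + (8 ℕ.* 2 ℕ.^ v₂ n) * + oddPart n       ≡⟨ cong (_* + oddPart n) (ℤ.pos-* 8 (2 ℕ.^ v₂ n)) ⟩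
  + 8 * + (2 ℕ.^ v₂ n) * + oddPart n       ≡⟨ ℤ.*-assoc (+ 8) (+ (2 ℕ.^ v₂ n)) (+ oddPart n) ⟩
  + 8 * coefficient (v₂ n) (oddPart n)     ≡⟨ cong (+ 8 *_) (coefficient-v₂ n) ⟩
  + 8 * + n                                ∎
  where open ≡-Reasoning

2*T : ∀ x → x * (x + 1ℤ) ≡ T x * + 2
2*T x = trans (a≡a%ℕn+[a/ℕn]*n (x * (x + 1ℤ)) 2) (trans (cong (λ r → + r + T x * + 2) remainder≡0) (ℤ.+-identityˡ _))
  where
  r = x %ℕ 2
  q = x /ℕ 2
  even : ∀ r → r ℕ.< 2 → x ≡ + r + q * + 2 → + 2 ∣ x * (x + 1ℤ)
  even 0 _ e = ∣m⇒∣m*n (x + 1ℤ) (divides q (trans e (ℤ.+-identityˡ _)))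
  even 1 _ e = ∣n⇒∣m*n x (divides (q + 1ℤ) (trans (cong (_+ 1ℤ) e) (eq q)))
    where
    eq : ∀ q → 1ℤ + q * + 2 + 1ℤ ≡ (q + 1ℤ) * + 2
    eq = solve-∀
  even (suc (suc _)) (ℕ.s≤s (ℕ.s≤s ())) _
  remainder≡0 : x * (x + 1ℤ) %ℕ 2 ≡ 0
  remainder≡0 = ≡mod⇒≡ (n%ℕd<d (x * (x + 1ℤ)) 2) (ℕ.s≤s ℕ.z≤n)
    (≡mod-trans (≡mod-sym (%ℕ-mod (x * (x + 1ℤ)) 2)) (∣⇒≡0 (even r (n%ℕd<d x 2) (a≡a%ℕn+[a/ℕn]*n x 2))))

complete-square : ∀ a x → + 8 * (+ a * x ^ 2) ≡ coefficient (3 ℕ.+ v₂ a) (oddPart a) * (x * x)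
complete-square a x = trans (eq (+ a) x) (cong (_* (x * x)) (sym (coefficient-3+v₂ a)))
  where
  eq : ∀ a x → + 8 * (a * (x * (x * 1ℤ))) ≡ + 8 * a * (x * x)
  eq = solve-∀

complete-triangular : ∀ a x → + 8 * (+ a * T x) + + a ≡ coefficient (v₂ a) (oddPart a) * ((+ 2 * x + 1ℤ) * (+ 2 * x + 1ℤ))
complete-triangular a x = begin
  + 8 * (+ a * T x) + + a                                        ≡⟨ eq₁ (+ a) (T x) ⟩
  + a * (+ 4 * (T x * + 2) + 1ℤ)                                 ≡⟨ cong (λ e → + a * (+ 4 * e + 1ℤ)) (2*T x) ⟨
  + a * (+ 4 * (x * (x + 1ℤ)) + 1ℤ)                              ≡⟨ eq₂ (+ a) x ⟩
  + a * ((+ 2 * x + 1ℤ) * (+ 2 * x + 1ℤ))                        ≡⟨ cong (_* ((+ 2 * x + 1ℤ) * (+ 2 * x + 1ℤ))) (coefficient-v₂ a) ⟨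
  coefficient (v₂ a) (oddPart a) * ((+ 2 * x + 1ℤ) * (+ 2 * x + 1ℤ)) ∎
  where
  open ≡-Reasoning
  eq₁ : ∀ a t → + 8 * (a * t) + a ≡ a * (+ 4 * (t * + 2) + 1ℤ)
  eq₁ = solve-∀
  eq₂ : ∀ a x → a * (+ 4 * (x * (x + 1ℤ)) + 1ℤ) ≡ a * ((+ 2 * x + 1ℤ) * (+ 2 * x + 1ℤ))
  eq₂ = solve-∀

-- The exponents of 2 in the diagonal form 8 F + s, where s completes the squares.
exponents : Form → (i j k : ℕ) → ℕ × ℕ × ℕ
exponents form₁ i j k = 3 ℕ.+ i , 3 ℕ.+ j , k
exponents form₂ i j k = i , j , 3 ℕ.+ k
exponents form₃ i j k = i , j , k
exponents form₄ i j k = 3 ℕ.+ i , j , 3 ℕ.+ k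
exponents form₅ i j k = 3 ℕ.+ i , j , k

module _ (a b c : ℕ) {{_ : NonZero a}} {{_ : NonZero b}} {{_ : NonZero c}} where

  isotropyOf : Form → Parity
  isotropyOf F = let i , j , k = exponents F (v₂ a) (v₂ b) (v₂ c) in
    isotropy (squareClass i (oddPart a)) (squareClass j (oddPart b)) (squareClass k (oddPart c))

  private
    Diagonalised : Form → ℤ → Set
    Diagonalised F s = let i , j , k = exponents F (v₂ a) (v₂ b) (v₂ c) in
      ∀ x y z → ∃[ X ] ∃[ Y ] ∃[ Z ] + 8 * eval F a b c x y z + s ≡
        value (coefficient i (oddPart a)) (coefficient j (oddPart b)) (coefficient k (oddPart c)) X Y Z

    anisotropicOf : ∀ F s → Diagonalised F s → AsymptoticallyUniversal F a b c → isotropyOf F ≡ 0ℙ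
    anisotropicOf F s diagonal AU = let i , j , k = exponents F (v₂ a) (v₂ b) (v₂ c) in
      Anisotropic.isotropy≡0
        (anisotropic {i} {_} {j} {_} {k} (oddPart-odd a) (oddPart-odd b) (oddPart-odd c))
        (oddUniversal⁺ {F} {a} {b} {c}
          (coefficient i (oddPart a)) (coefficient j (oddPart b)) (coefficient k (oddPart c)) s diagonal AU)

    +-cong₃ : ∀ {x x′ y y′ z z′ : ℤ} → x ≡ x′ → y ≡ y′ → z ≡ z′ → x + y + z ≡ x′ + y′ + z′
    +-cong₃ refl refl refl = refl

  not-universal : ∀ F → isotropyOf F ≡ 1ℙ → ¬ AsymptoticallyUniversal F a b c
  not-universal F v≡1 AU = contradiction (trans (sym v≡1) (isotropyOf≡0 F AU)) λ ()
    where
    isotropyOf≡0 : ∀ F → AsymptoticallyUniversal F a b c → isotropyOf F ≡ 0ℙ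
    isotropyOf≡0 form₁ = anisotropicOf form₁ (+ c) λ x y z → x , y , + 2 * z + 1ℤ ,
      trans (eq (+ a * x ^ 2) (+ b * y ^ 2) (+ c * T z) (+ c))
        (+-cong₃ (complete-square a x) (complete-square b y) (complete-triangular c z))
      where
      eq : ∀ x y z c → + 8 * (x + y + z) + c ≡ + 8 * x + + 8 * y + (+ 8 * z + c)
      eq = solve-∀
    isotropyOf≡0 form₂ = anisotropicOf form₂ (+ a + + b) λ x y z → + 2 * x + 1ℤ , + 2 * y + 1ℤ , z ,
      trans (eq (+ a * T x) (+ b * T y) (+ c * z ^ 2) (+ a) (+ b))
        (+-cong₃ (complete-triangular a x) (complete-triangular b y) (complete-square c z))
      where
      eq : ∀ x y z a b → + 8 * (x + y + z) + (a + b) ≡ + 8 * x + a + (+ 8 * y + b) + + 8 * z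
      eq = solve-∀
    isotropyOf≡0 form₃ = anisotropicOf form₃ (+ a + + b + + c) λ x y z → + 2 * x + 1ℤ , + 2 * y + 1ℤ , + 2 * z + 1ℤ ,
      trans (eq (+ a * T x) (+ b * T y) (+ c * T z) (+ a) (+ b) (+ c))
        (+-cong₃ (complete-triangular a x) (complete-triangular b y) (complete-triangular c z))
      where
      eq : ∀ x y z a b c → + 8 * (x + y + z) + (a + b + c) ≡ + 8 * x + a + (+ 8 * y + b) + (+ 8 * z + c)
      eq = solve-∀
    isotropyOf≡0 form₄ = anisotropicOf form₄ (+ b) λ x y z → x , + 2 * y + 1ℤ , z ,
      trans (eq (+ a * x ^ 2) (+ b * T y) (+ c * z ^ 2) (+ b))
        (+-cong₃ (complete-square a x) (complete-triangular b y) (complete-square c z))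
      where
      eq : ∀ x y z b → + 8 * (x + y + z) + b ≡ + 8 * x + (+ 8 * y + b) + + 8 * z
      eq = solve-∀
    isotropyOf≡0 form₅ = anisotropicOf form₅ (+ b + + c) λ x y z → x , + 2 * y + 1ℤ , + 2 * z + 1ℤ ,
      trans (eq (+ a * x ^ 2) (+ b * T y) (+ c * T z) (+ b) (+ c))
        (+-cong₃ (complete-square a x) (complete-triangular b y) (complete-triangular c z))
      where
      eq : ∀ x y z b c → + 8 * (x + y + z) + (b + c) ≡ + 8 * x + (+ 8 * y + b) + (+ 8 * z + c)
      eq = solve-∀

%-cong : ∀ {n} .{{_ : NonZero n}} {A B} → + A ≡ + B [mod n ] → A ℕ.% n ≡ B ℕ.% n
%-cong {n} {A} {B} A≡B = ≡mod⇒≡ (ℕ.m%n<n A n) (ℕ.m%n<n B n)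
  (≡mod-trans (≡mod-sym (%ℕ-mod (+ A) n)) (≡mod-trans (congruent A≡B) (%ℕ-mod (+ B) n)))

module _ {X : Set} (f : ℕ → X) {n : ℕ} {{_ : NonZero n}} (periodic : ∀ k → f (n ℕ.+ k) ≡ f k) where

  periodic-% : ∀ A → f A ≡ f (A ℕ.% n)
  periodic-% A = trans (cong f (trans (ℕ.m≡m%n+[m/n]*n A n) (ℕ.+-comm (A ℕ.% n) _))) (go (A ℕ./ n))
    where
    go : ∀ q → f (q ℕ.* n ℕ.+ A ℕ.% n) ≡ f (A ℕ.% n)
    go zero    = refl
    go (suc q) = trans (cong f (ℕ.+-assoc n (q ℕ.* n) _)) (trans (periodic _) (go q))

  periodic-cong : ∀ A B → + A ≡ + B [mod n ] → f A ≡ f B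
  periodic-cong A B A≡B = trans (periodic-% A) (trans (cong f (%-cong {n} {A} {B} A≡B)) (sym (periodic-% B)))

χ : ℕ → Parity × Parity
χ A = χ₄ A , χ₈ A

χ-periodic : ∀ A → χ (8 ℕ.+ A) ≡ χ A
χ-periodic A = cong (χ₄ A ,_)
  (solve 3 (λ t a b → t :+ a :+ b :+ a :+ b := t) refl (χ₈ A) (parity (suc ⌊ A /2⌋)) (χ₄ A))
  where open ℙ-Solver

χ-cong : ∀ A B → + A ≡ + B [mod 8 ] → χ A ≡ χ B
χ-cong = periodic-cong χ χ-periodic

χ-neg : ∀ A {B} → Odd B → + A ≡ - + B [mod 8 ] → χ A ≡ (1ℙ ℙ.+ χ₄ B , χ₈ B)
χ-neg A {B} oB A≡-B = trans
  (χ-cong A (7 ℕ.* B) (subst (λ e → + 8 ∣ + A - e) (sym (ℤ.pos-* 7 B))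
    (∣-lin₂ 1ℤ (- + B) (eq (+ A) (+ B)) A≡-B ∣-refl)))
  (cong₂ _,_ (χ₄-* {7} (odd refl) oB) (χ₈-* {7} (odd refl) oB))
  where
  eq : ∀ a b → a - + 7 * b ≡ 1ℤ * (a - - b) + - b * + 8
  eq = solve-∀

χ-+4 : ∀ C {p q} → χ (4 ℕ.+ C) ≡ (p , q) → χ C ≡ (p , 1ℙ ℙ.+ q)
χ-+4 C refl = cong (χ₄ C ,_) (sym (trans (cong (λ e → 1ℙ ℙ.+ (χ₈ C ℙ.+ e ℙ.+ χ₄ C)) (parity-suc ⌊ C /2⌋))
  (solve 2 (λ t a → con 1ℙ :+ (t :+ (con 1ℙ :+ a) :+ a) := t) refl (χ₈ C) (χ₄ C))))
  where open ℙ-Solver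

classOf : Parity → Parity × Parity → Class
classOf i (a , h) = class i a h

p+p*p≡0ℙ : ∀ p → p ℙ.+ (p ℙ.* p) ≡ 0ℙ
p+p*p≡0ℙ 0ℙ = refl
p+p*p≡0ℙ 1ℙ = refl

module _ (i j k b h : Parity) where

  open ℙ-Solver

  isotropy-opposite : isotropy (class i b h) (class j b h) (class k (1ℙ ℙ.+ b) h) ≡ 1ℙ
  isotropy-opposite = trans
    (solve 5 (λ i j k b h →
      (b :+ b :+ (con 1ℙ :+ b) :+ (b :* b) :+ (b :* (con 1ℙ :+ b)) :+ ((con 1ℙ :+ b) :* b)) :+
      (((j :+ k) :* h) :+ ((k :+ i) :* h) :+ ((i :+ j) :* h)) := con 1ℙ :+ (b :+ (b :* b))) refl i j k b h)
    (cong (1ℙ ℙ.+_) (p+p*p≡0ℙ b))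

  isotropy-shift : isotropy (class i b h) (class j b h) (class k b (1ℙ ℙ.+ h)) ≡ i ℙ.+ j
  isotropy-shift = trans
    (solve 5 (λ i j k b h →
      (b :+ b :+ b :+ (b :* b) :+ (b :* b) :+ (b :* b)) :+
      (((j :+ k) :* h) :+ ((k :+ i) :* h) :+ ((i :+ j) :* (con 1ℙ :+ h))) := (i :+ j) :+ (b :+ (b :* b))) refl i j k b h)
    (trans (cong (i ℙ.+ j ℙ.+_) (p+p*p≡0ℙ b)) (ℙ.+-identityʳ _))

  isotropy-opposite-shift⁺ : isotropy (class i (1ℙ ℙ.+ b) h) (class j b h) (class k (1ℙ ℙ.+ b) (1ℙ ℙ.+ h)) ≡ 1ℙ ℙ.+ (i ℙ.+ j)
  isotropy-opposite-shift⁺ = trans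
    (solve 5 (λ i j k b h →
      ((con 1ℙ :+ b) :+ b :+ (con 1ℙ :+ b) :+ ((con 1ℙ :+ b) :* b) :+ (b :* (con 1ℙ :+ b)) :+ ((con 1ℙ :+ b) :* (con 1ℙ :+ b))) :+
      (((j :+ k) :* h) :+ ((k :+ i) :* h) :+ ((i :+ j) :* (con 1ℙ :+ h))) := con 1ℙ :+ (i :+ j) :+ (b :+ (b :* b))) refl i j k b h)
    (trans (cong (1ℙ ℙ.+ (i ℙ.+ j) ℙ.+_) (p+p*p≡0ℙ b)) (ℙ.+-identityʳ _))

  isotropy-opposite-shift⁻ : isotropy (class i b h) (class j b h) (class k (1ℙ ℙ.+ b) (1ℙ ℙ.+ h)) ≡ 1ℙ ℙ.+ (i ℙ.+ j)
  isotropy-opposite-shift⁻ = trans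
    (solve 5 (λ i j k b h →
      (b :+ b :+ (con 1ℙ :+ b) :+ (b :* b) :+ (b :* (con 1ℙ :+ b)) :+ ((con 1ℙ :+ b) :* b)) :+
      (((j :+ k) :* h) :+ ((k :+ i) :* h) :+ ((i :+ j) :* (con 1ℙ :+ h))) := con 1ℙ :+ (i :+ j) :+ (b :+ (b :* b))) refl i j k b h)
    (trans (cong (1ℙ ℙ.+ (i ℙ.+ j) ℙ.+_) (p+p*p≡0ℙ b)) (ℙ.+-identityʳ _))

parity-sum-same : ∀ m n → + m ≡ + n [mod 2 ] → parity m ℙ.+ parity n ≡ 0ℙ
parity-sum-same m n e =
  trans (cong (ℙ._+ parity n) (periodic-cong parity {2} (λ _ → refl) m n e)) (ℙ.p+p≡0ℙ (parity n))

parity-sum-different : ∀ m n → ¬ + m ≡ + n [mod 2 ] → parity m ℙ.+ parity n ≡ 1ℙ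
parity-sum-different m n m≢n with parity m ℙ.+ parity n in e
... | 1ℙ = refl
... | 0ℙ = contradiction
  (subst (+ 2 ∣_) (eq (+ m) (+ n))
    (∣m∣n⇒∣m-n {m = + (m ℕ.+ n)} {+ n * + 2} (∣ᵤ⇒∣ 2∣m+n) (∣n⇒∣m*n (+ n) ∣-refl)))
  m≢n
  where
  2∣m+n : 2 ℕ.∣ m ℕ.+ n
  2∣m+n = parity≡0⇒2∣ (m ℕ.+ n) (trans (ℙ.+-homo-+ m n) e)
  eq : ∀ m n → m + n - n * + 2 ≡ m - n
  eq = solve-∀

module _ (a b c : ℕ) {{_ : NonZero a}} {{_ : NonZero b}} {{_ : NonZero c}} where

  private
    a′ b′ c′ : ℤ
    a′ = + oddPart a
    b′ = + oddPart b
    c′ = + oddPart c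

    i j k split : Form → Parity
    i F = parity (proj₁ (exponents F (v₂ a) (v₂ b) (v₂ c)))
    j F = parity (proj₁ (proj₂ (exponents F (v₂ a) (v₂ b) (v₂ c))))
    k F = parity (proj₂ (proj₂ (exponents F (v₂ a) (v₂ b) (v₂ c))))
    split F = i F ℙ.+ j F

    isotropyOf-χ : ∀ F {p r} → χ (oddPart a) ≡ p → χ (oddPart c) ≡ r →
      isotropyOf a b c F ≡ isotropy (classOf (i F) p) (classOf (j F) (χ (oddPart b))) (classOf (k F) r)
    isotropyOf-χ F refl refl = refl

  isotropyOf-opposite : (a′ ≡ b′ [mod 8 ]) × (b′ ≡ - c′ [mod 8 ]) → ∀ F → isotropyOf a b c F ≡ 1ℙ
  isotropyOf-opposite (a≡b , b≡-c) F = trans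
    (isotropyOf-χ F (χ-cong (oddPart a) (oddPart b) a≡b) (χ-neg (oddPart c) (oddPart-odd b) (∣-lin₁ 1ℤ (eq b′ c′) b≡-c)))
    (isotropy-opposite (i F) (j F) (k F) (χ₄ (oddPart b)) (χ₈ (oddPart b)))
    where
    eq : ∀ b c → c - - b ≡ 1ℤ * (b - - c)
    eq = solve-∀

  isotropyOf-condition₁ : (a′ ≡ b′ [mod 8 ]) × (b′ ≡ c′ + + 4 [mod 8 ]) → ∀ F → isotropyOf a b c F ≡ split F
  isotropyOf-condition₁ (a≡b , b≡c+4) F = trans
    (isotropyOf-χ F (χ-cong (oddPart a) (oddPart b) a≡b)
      (χ-+4 (oddPart c) (χ-cong (4 ℕ.+ oddPart c) (oddPart b) (∣-lin₁ -1ℤ (eq b′ c′) b≡c+4))))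
    (isotropy-shift (i F) (j F) (k F) (χ₄ (oddPart b)) (χ₈ (oddPart b)))
    where
    eq : ∀ b c → + 4 + c - b ≡ -1ℤ * (b - (c + + 4))
    eq = solve-∀

  isotropyOf-condition₂ :
    ∃[ ε ] ((ε ≡ 1ℤ ⊎ ε ≡ -1ℤ) × (ε * a′ ≡ - b′ [mod 8 ]) × (- b′ ≡ c′ + + 4 [mod 8 ])) →
    ∀ F → isotropyOf a b c F ≡ 1ℙ ℙ.+ split F
  isotropyOf-condition₂ (ε , ε≡ , εa≡-b , -b≡c+4) F = case ε≡ εa≡-b
    where
    χc : χ (oddPart c) ≡ (1ℙ ℙ.+ χ₄ (oddPart b) , 1ℙ ℙ.+ χ₈ (oddPart b))
    χc = χ-+4 (oddPart c) (χ-neg (4 ℕ.+ oddPart c) (oddPart-odd b) (∣-lin₁ -1ℤ (eq b′ c′) -b≡c+4))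
      where
      eq : ∀ b c → + 4 + c - - b ≡ -1ℤ * (- b - (c + + 4))
      eq = solve-∀
    case : ε ≡ 1ℤ ⊎ ε ≡ -1ℤ → ε * a′ ≡ - b′ [mod 8 ] → isotropyOf a b c F ≡ 1ℙ ℙ.+ split F
    case (inj₁ refl) a≡-b = trans
      (isotropyOf-χ F (χ-neg (oddPart a) (oddPart-odd b) (∣-lin₁ 1ℤ (eq a′ b′) a≡-b)) χc)
      (isotropy-opposite-shift⁺ (i F) (j F) (k F) (χ₄ (oddPart b)) (χ₈ (oddPart b)))
      where
      eq : ∀ a b → a - - b ≡ 1ℤ * (1ℤ * a - - b)
      eq = solve-∀
    case (inj₂ refl) -a≡-b = trans
      (isotropyOf-χ F (χ-cong (oddPart a) (oddPart b) (∣-lin₁ -1ℤ (eq a′ b′) -a≡-b)) χc)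
      (isotropy-opposite-shift⁻ (i F) (j F) (k F) (χ₄ (oddPart b)) (χ₈ (oddPart b)))
      where
      eq : ∀ a b → a - b ≡ -1ℤ * (-1ℤ * a - - b)
      eq = solve-∀

corollary1p4 :
    ∀ (a b c : ℕ) {{_ : NonZero a}} {{_ : NonZero b}} {{_ : NonZero c}} →
    let a′ = + oddPart a
        b′ = + oddPart b
        c′ = + oddPart c
        SameParity = + v₂ a ≡ + v₂ b [mod 2 ]
        Condition₁ = (a′ ≡ b′ [mod 8 ]) × (b′ ≡ c′ + + 4 [mod 8 ])
        Condition₂ = ∃[ ε ] ((ε ≡ 1ℤ ⊎ ε ≡ -1ℤ) ×
                             (ε * a′ ≡ - b′ [mod 8 ]) × (- b′ ≡ c′ + + 4 [mod 8 ]))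
    in
    ((a′ ≡ b′ [mod 8 ]) × (b′ ≡ - c′ [mod 8 ]) →
       ¬ AsymptoticallyUniversal form₁ a b c ×
       ¬ AsymptoticallyUniversal form₂ a b c ×
       ¬ AsymptoticallyUniversal form₃ a b c ×
       ¬ AsymptoticallyUniversal form₄ a b c ×
       ¬ AsymptoticallyUniversal form₅ a b c)
    ×
    ((Condition₁ × ¬ SameParity) ⊎ (Condition₂ × SameParity) →
       ¬ AsymptoticallyUniversal form₁ a b c ×
       ¬ AsymptoticallyUniversal form₂ a b c ×
       ¬ AsymptoticallyUniversal form₃ a b c)
    ×
    ((Condition₁ × SameParity) ⊎ (Condition₂ × ¬ SameParity) →
       ¬ AsymptoticallyUniversal form₄ a b c ×
       ¬ AsymptoticallyUniversal form₅ a b c)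
corollary1p4 a b c = 
  (λ cond → let p = isotropyOf-opposite a b c cond in
    refute form₁ (p form₁) , refute form₂ (p form₂) , refute form₃ (p form₃) , refute form₄ (p form₄) , refute form₅ (p form₅)) ,
  (λ where
    (inj₁ (cond , different)) →
      let p = isotropyOf-condition₁ a b c cond
          e = parity-sum-different (v₂ a) (v₂ b) different
      in refute form₁ (trans (p form₁) (trans even-shift e)) ,
         refute form₂ (trans (p form₂) e) ,
         refute form₃ (trans (p form₃) e)
    (inj₂ (cond , same)) →
      let p = isotropyOf-condition₂ a b c cond
          e = cong (1ℙ ℙ.+_) (parity-sum-same (v₂ a) (v₂ b) same)
      in refute form₁ (trans (p form₁) (trans (cong (1ℙ ℙ.+_) even-shift) e)) ,
         refute form₂ (trans (p form₂) e) ,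
         refute form₃ (trans (p form₃) e)) ,
  (λ where
    (inj₁ (cond , same)) →
      let p = isotropyOf-condition₁ a b c cond
          e = trans odd-shift (cong (1ℙ ℙ.+_) (parity-sum-same (v₂ a) (v₂ b) same))
      in refute form₄ (trans (p form₄) e) , refute form₅ (trans (p form₅) e)
    (inj₂ (cond , different)) →
      let p = isotropyOf-condition₂ a b c cond
          e = cong (1ℙ ℙ.+_) (trans odd-shift (cong (1ℙ ℙ.+_) (parity-sum-different (v₂ a) (v₂ b) different)))
      in refute form₄ (trans (p form₄) e) , refute form₅ (trans (p form₅) e))
  where
  i j s : Parity
  i = parity (v₂ a)
  j = parity (v₂ b)
  s = i ℙ.+ j
  even-shift : parity (3 ℕ.+ v₂ a) ℙ.+ parity (3 ℕ.+ v₂ b) ≡ s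
  even-shift = trans (cong₂ ℙ._+_ (parity-suc (v₂ a)) (parity-suc (v₂ b))) (eq i j)
    where
    open ℙ-Solver
    eq : ∀ i j → (1ℙ ℙ.+ i) ℙ.+ (1ℙ ℙ.+ j) ≡ i ℙ.+ j
    eq = solve 2 (λ i j → (con 1ℙ :+ i) :+ (con 1ℙ :+ j) := i :+ j) refl
  odd-shift : parity (3 ℕ.+ v₂ a) ℙ.+ j ≡ 1ℙ ℙ.+ s
  odd-shift = trans (cong (ℙ._+ j) (parity-suc (v₂ a))) (ℙ.+-assoc 1ℙ i j)
  refute : ∀ F → isotropyOf a b c F ≡ 1ℙ → ¬ AsymptoticallyUniversal F a b c
  refute = not-universal a b c
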